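{- Let $S_3=\{(3,0,-2,0),(1,-1,-2,1),(2,-1,-2,0)\}$. If $(t_1,t_2,t_3,t_4)\in S_3$, then for all integers $n\geq 0$, $$a_{1^{t_1}2^{t_2}3^{t_3}4^{t_4}}(3n)>0,\qquad a_{1^{t_1}2^{t_2}3^{t_3}4^{t_4}}(3n+1)<0,\qquad a_{1^{t_1}2^{t_2}3^{t_3}4^{t_4}}(3n+2)=0.$$
   Context: For $|q|<1$ (or as formal power series in $q$) let $f_j:=(q^j;q^j)_\infty=\prod_{k\ge 1}(1-q^{jk})$ for each positive integer $j$. For a positive integer $m$ and integers $t_1,\dots,t_m$ (possibly zero or negative), the integers $a_{1^{t_1}2^{t_2}\cdots m^{t_m}}(n)$, $n\ge 0$, are defined by $\sum_{n=0}^\infty a_{1^{t_1}2^{t_2}\cdots m^{t_m}}(n)q^n=f_1^{t_1}f_2^{t_2}\cdots f_m^{t_m}$. Factors with exponent $0$ may be omitted from the notation. -}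

module Defs where

open import Algebra.Bundles.Raw using (RawSemiring)
import Algebra.Definitions.RawSemiring as RawSemiringDefs
open import Data.Bool.Base using (if_then_else_)
open import Data.Fin.Base using (Fin; zero; suc; toℕ)
open import Data.Integer.Base as ℤ using (ℤ; +_; -[1+_]; -_; 0ℤ; 1ℤ)
import Data.Integer.Properties as ℤ
open import Data.List.Base as List using (List)
open import Data.Nat.Base as ℕ using (ℕ; zero; suc; _∸_; _≡ᵇ_; _≤_; _<_; z≤n; s≤s; NonZero)
import Data.Nat.Properties as ℕ
open import Data.Product.Base using (∃-syntax; _,_)
open import Data.Vec.Base using (Vec; []; _∷_; head; lookup)
open import Function.Base using (_∘_)
open import Level using (0ℓ)
open import Relation.Binary.PropositionalEquality
open import Algebra.Properties.Monoid.Sum ℤ.+-0-monoid using (sum⁺-syntax; sum-syntax; sum-cong-≗)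

-- A formal power series in q over ℤ, given by its coefficients.
PowerSeries : Set
PowerSeries = ℕ → ℤ

infixl 6 _⊕_ _⊖_
infixl 7 _⊛_

_⊕_ _⊖_ _⊛_ : PowerSeries → PowerSeries → PowerSeries
(g ⊕ h) n = g n ℤ.+ h n
(g ⊖ h) n = g n ℤ.- h n
(g ⊛ h) n = ∑[ i ≤ n ] (g (toℕ i) ℤ.* h (n ∸ toℕ i))

q^_ : ℕ → PowerSeries
(q^ m) n = if m ≡ᵇ n then 1ℤ else 0ℤ

powerSeries : RawSemiring 0ℓ 0ℓ
powerSeries = record
  { Carrier = PowerSeries
  ; _≈_     = _≗_
  ; _+_     = _⊕_
  ; _*_     = _⊛_
  ; 0#      = λ _ → 0ℤ
  ; 1#      = q^ 0
  }

open RawSemiringDefs powerSeries public using (_^_; product)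

-- The coefficients h n , … , h 0 (in this order) of the series h with
-- g ⊛ h ≗ q^ 0, for g with constant term 1: for n ≥ 1 they satisfy
-- h n = - (g 1 * h (n - 1) + … + g n * h 0).
inverseCoeffs : PowerSeries → (n : ℕ) → Vec ℤ (suc n)
inverseCoeffs g zero    = 1ℤ ∷ []
inverseCoeffs g (suc n) =
  - (∑[ i ≤ n ] (g (suc (toℕ i)) ℤ.* lookup hs i)) ∷ hs
  where hs = inverseCoeffs g n

-- Meaningful only for series with constant term 1; see ⁻¹-inverseʳ.
infix 9 _⁻¹
_⁻¹ : PowerSeries → PowerSeries
(g ⁻¹) n = head (inverseCoeffs g n)

infixr 8 _^ℤ_
_^ℤ_ : PowerSeries → ℤ → PowerSeries
g ^ℤ (+ n)    = g ^ n
g ^ℤ -[1+ n ] = (g ⁻¹) ^ suc n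

-- ∏_{k=1}^{K} (1 - q^{jk})
partialProduct : ℕ → ℕ → PowerSeries
partialProduct j zero    = q^ 0
partialProduct j (suc K) = partialProduct j K ⊛ (q^ 0 ⊖ q^ (j ℕ.* suc K))

-- f_j = ∏_{k≥1} (1 - q^{jk}). The factors with k > n do not affect the
-- coefficient of q^n, so that coefficient is read off the n-th partial
-- product; see f-isLimit.
f : (j : ℕ) → .{{NonZero j}} → PowerSeries
f j n = partialProduct j n n

-- The vector t₁ ∷ … ∷ tₘ ∷ [] gives the exponents of f₁ , … , fₘ.
a : ∀ {m} → Vec ℤ m → ℕ → ℤ
a t = product (λ i → f (suc (toℕ i)) ^ℤ lookup t i)

S₃ : List (Vec ℤ 4)
S₃ = (+ 3 ∷ + 0   ∷ - + 2 ∷ + 0 ∷ [])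
   List.∷ (+ 1 ∷ - + 1 ∷ - + 2 ∷ + 1 ∷ [])
   List.∷ (+ 2 ∷ - + 1 ∷ - + 2 ∷ + 0 ∷ [])
   List.∷ List.[]

-- Convergence in the q-adic topology.
_IsLimitOf_ : PowerSeries → (ℕ → PowerSeries) → Set
g IsLimitOf gs = ∀ n → ∃[ N ] (∀ K → N ≤ K → gs K n ≡ g n)

private
  q^-low : ∀ {m n} → n < m → (q^ m) n ≡ 0ℤ
  q^-low {suc m} {zero}  _         = refl
  q^-low {suc m} {suc n} (s≤s n<m) = q^-low n<m

  ⊛-one-upto : ∀ n g h → h 0 ≡ 1ℤ → (∀ k → suc k ≤ n → h (suc k) ≡ 0ℤ) →
               (g ⊛ h) n ≡ g n
  ⊛-one-upto zero g h h₀ _ = begin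
    g 0 ℤ.* h 0 ℤ.+ 0ℤ  ≡⟨ ℤ.+-identityʳ _ ⟩
    g 0 ℤ.* h 0         ≡⟨ cong (g 0 ℤ.*_) h₀ ⟩
    g 0 ℤ.* 1ℤ          ≡⟨ ℤ.*-identityʳ (g 0) ⟩
    g 0                 ∎
    where open ≡-Reasoning
  ⊛-one-upto (suc n) g h h₀ h₊ = begin
    g 0 ℤ.* h (suc n) ℤ.+ ((g ∘ suc) ⊛ h) n
      ≡⟨ cong₂ ℤ._+_ (cong (g 0 ℤ.*_) (h₊ n ℕ.≤-refl))
                     (⊛-one-upto n (g ∘ suc) h h₀ (λ k k<n → h₊ k (ℕ.m≤n⇒m≤1+n k<n))) ⟩
    g 0 ℤ.* 0ℤ ℤ.+ g (suc n)  ≡⟨ cong (ℤ._+ g (suc n)) (ℤ.*-zeroʳ (g 0)) ⟩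
    0ℤ ℤ.+ g (suc n)          ≡⟨ ℤ.+-identityˡ _ ⟩
    g (suc n)                 ∎
    where open ≡-Reasoning

  ⊛-factor : ∀ {m n} g → n < m → (g ⊛ (q^ 0 ⊖ q^ m)) n ≡ g n
  ⊛-factor {m} {n} g n<m = ⊛-one-upto n g (q^ 0 ⊖ q^ m)
    (cong (λ x → 1ℤ ℤ.- x) (q^-low (ℕ.≤-<-trans z≤n n<m)))
    (λ k k<n → cong (λ x → 0ℤ ℤ.- x) (q^-low (ℕ.≤-<-trans k<n n<m)))

f-isLimit : ∀ j .{{_ : NonZero j}} → f j IsLimitOf partialProduct j
f-isLimit j n = n , λ K n≤K → stable (ℕ.≤⇒≤′ n≤K)
  where
  stable : ∀ {K} → n ℕ.≤′ K → partialProduct j K n ≡ partialProduct j n n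
  stable ℕ.≤′-refl = refl
  stable (ℕ.≤′-step {n = K} n≤K) = trans
    (⊛-factor (partialProduct j K)
      (ℕ.≤-trans (s≤s (ℕ.≤′⇒≤ n≤K)) (ℕ.m≤n*m (suc K) j)))
    (stable n≤K)

⁻¹-inverseʳ : ∀ g → g 0 ≡ 1ℤ → g ⊛ g ⁻¹ ≗ q^ 0
⁻¹-inverseʳ g g₀ zero    = cong (λ x → x ℤ.* 1ℤ ℤ.+ 0ℤ) g₀
⁻¹-inverseʳ g g₀ (suc n) = begin
  g 0 ℤ.* - s ℤ.+ s′  ≡⟨ cong (λ x → x ℤ.* - s ℤ.+ s′) g₀ ⟩
  1ℤ ℤ.* - s ℤ.+ s′   ≡⟨ cong (ℤ._+ s′) (ℤ.*-identityˡ (- s)) ⟩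
  - s ℤ.+ s′          ≡⟨ cong (λ x → - s ℤ.+ x)
                           (sum-cong-≗ (λ i → cong (g (suc (toℕ i)) ℤ.*_) (sym (lookup-inverse n i)))) ⟩
  - s ℤ.+ s           ≡⟨ ℤ.+-inverseˡ s ⟩
  0ℤ                  ∎
  where
  open ≡-Reasoning
  s s′ : ℤ
  s  = ∑[ i ≤ n ] (g (suc (toℕ i)) ℤ.* lookup (inverseCoeffs g n) i)
  s′ = ((g ∘ suc) ⊛ g ⁻¹) n

  lookup-inverse : ∀ n (i : Fin (suc n)) →
                   lookup (inverseCoeffs g n) i ≡ (g ⁻¹) (n ∸ toℕ i)
  lookup-inverse zero    zero    = refl
  lookup-inverse (suc n) zero    = refl
  lookup-inverse (suc n) (suc i) = lookup-inverse n i

f-constantTerm : ∀ j .{{_ : NonZero j}} → f j 0 ≡ 1ℤ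
f-constantTerm j = refl

-- Each numerator f₁³, f₁f₄/f₂, f₁²/f₂ is a Ramanujan theta function
-- f(a,b) = Σ a^(n(n+1)/2) b^(n(n-1)/2), or a derivative of one, by Jacobi's triple
-- product. Sorting the series by the residue of n modulo 3 gives three theta functions
-- again, whose product forms show that the numerator is A(q³) - q B(q³). For the last
-- two numerators, every factor 1 - q^(3k) of A(q³) and B(q³) cancels against f₃², which
-- leaves products of factors 1/(1 - q^(3k)) and 1 + q^(3k), hence positive coefficients.
--
-- For f₁³ the theta function f(-z,-q/z) vanishes at z = 1, so it is expanded over the
-- dual numbers at z = 1 + ε. There A(q³) = f₃ (1 + 6 Σ (x/(1-x) - q³x/(1-q³x))),
-- summed over x = q^(9i+3); the i-th term is x(1-q³)/((1-x)(1-q³x)), and dividing by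
-- f₃ removes its factor 1 - q³. The other part is B(q³)/f₃² = 3 f₉³/f₃², the theta
-- function f(q³,q⁶) times factors 1/(1 - q^(3k)).

module Submission where

open import Algebra.Bundles using (CommutativeRing; Semiring)
import Algebra.Definitions.RawSemiring as RawSemiringDefs
open import Data.Integer.Base as ℤ using (ℤ; 0ℤ)
import Data.Integer.Properties as ℤ
import Data.Maybe.Base as Maybe
open import Data.Nat.Base as ℕ using (ℕ; zero; suc; z≤n; s≤s; NonZero)
import Data.Nat.Properties as ℕ
import Data.Nat.Tactic.RingSolver as ℕSolver
open import Data.Product.Base using (_×_; _,_; proj₁; proj₂; ∃-syntax)
open import Data.Sum.Base using (inj₁; inj₂)
open import Function.Base using (_∘_)
open import Level using (0ℓ)
open import Relation.Binary.Consequences using (dec⇒weaklyDec)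
open import Relation.Binary.Definitions using (WeaklyDecidable)
import Relation.Binary.PropositionalEquality as ≡

-- The theta-function part works in an arbitrary commutative ring with a separated filtration,
-- because the triple product and the dissections are applied twice: to power series, and to dual
-- numbers over them. The parameters of f(a,b) need not be invertible, so no Laurent polynomials
-- occur: positive and negative indices are the two families `w a b` and `w b a`, and a dissection
-- is an equality of two limits, settled by separatedness.
--
-- The positivity asked for is strict at every multiple of 3, which nonnegative factors do not give
-- by themselves. Each quotient is therefore arranged to keep a factor 1/(1 - q^3): if (1 - q^3) g
-- has nonnegative coefficients and constant term 1, and g is a series in q^3, then the coefficients
-- of g at 0, 3, 6, ... are at least 1. Further summands then only need nonnegative coefficients.

-- Ring solver with integer coefficients

module RingSolving {c ℓ} (R : CommutativeRing c ℓ) where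
  open import Algebra.Properties.Ring (CommutativeRing.ring R)
    using (-‿distribˡ-*; -‿distribʳ-*; -0#≈0#; -‿involutive; -‿+-comm)
  open import Algebra.Properties.Semiring.Mult.TCOptimised (CommutativeRing.semiring R)
    using (1+×; ×-homo-+; ×1-homo-*) renaming (_×_ to _×ᴿ_)
  open import Algebra.Solver.Ring.AlmostCommutativeRing
    using (fromCommutativeRing; _-Raw-AlmostCommutative⟶_; Induced-equivalence)
  open import Data.Integer.Base using (+_; -[1+_])
  open CommutativeRing R
  open import Relation.Binary.Reasoning.Setoid setoid

  -- Equality in the ring need not be decidable, so the solver computes with integer coefficients.
  -- The optimised multiple sends 1 to `1#` itself, which is why `1-homo` is `refl`.
  ⟦_⟧ℤ : ℤ → Carrier
  ⟦ + n ⟧ℤ      = n ×ᴿ 1#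
  ⟦ -[1+ n ] ⟧ℤ = - (suc n ×ᴿ 1#)

  cancel-one : ∀ x y → (1# + x) - (1# + y) ≈ x - y
  cancel-one x y = begin
    (1# + x) + - (1# + y)      ≈⟨ +-cong (+-comm 1# x) (sym (-‿+-comm 1# y)) ⟩
    (x + 1#) + (- 1# + - y)    ≈⟨ +-assoc x 1# _ ⟩
    x + (1# + (- 1# + - y))    ≈⟨ +-congˡ (sym (+-assoc 1# (- 1#) (- y))) ⟩
    x + ((1# + - 1#) + - y)    ≈⟨ +-congˡ (trans (+-congʳ (-‿inverseʳ 1#)) (+-identityˡ (- y))) ⟩
    x - y                      ∎

  ⊖-homo : ∀ m n → ⟦ m ℤ.⊖ n ⟧ℤ ≈ m ×ᴿ 1# - n ×ᴿ 1#
  ⊖-homo m zero = sym (trans (+-congˡ -0#≈0#) (+-identityʳ _))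
  ⊖-homo zero (suc n) = sym (+-identityˡ _)
  ⊖-homo (suc m) (suc n) = begin
    ⟦ suc m ℤ.⊖ suc n ⟧ℤ       ≡⟨ ≡.cong ⟦_⟧ℤ (ℤ.[1+m]⊖[1+n]≡m⊖n m n) ⟩
    ⟦ m ℤ.⊖ n ⟧ℤ               ≈⟨ ⊖-homo m n ⟩
    m ×ᴿ 1# - n ×ᴿ 1#            ≈⟨ sym
        (trans (+-cong (1+× m 1#) (-‿cong (1+× n 1#))) (cancel-one _ _)) ⟩
    suc m ×ᴿ 1# - suc n ×ᴿ 1#    ∎

  +-homo : ∀ i j → ⟦ i ℤ.+ j ⟧ℤ ≈ ⟦ i ⟧ℤ + ⟦ j ⟧ℤ
  +-homo (+ m) (+ n) = ×-homo-+ 1# m n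
  +-homo (+ m) -[1+ n ] = ⊖-homo m (suc n)
  +-homo -[1+ m ] (+ n) = trans (⊖-homo n (suc m)) (+-comm _ _)
  +-homo -[1+ m ] -[1+ n ] = begin
    - (suc (suc (m ℕ.+ n)) ×ᴿ 1#)        ≡⟨ ≡.cong (λ k → - (suc k ×ᴿ 1#)) (≡.sym (ℕ.+-suc m n)) ⟩
    - ((suc m ℕ.+ suc n) ×ᴿ 1#)          ≈⟨ -‿cong (×-homo-+ 1# (suc m) (suc n)) ⟩
    - (suc m ×ᴿ 1# + suc n ×ᴿ 1#)         ≈⟨ sym (-‿+-comm _ _) ⟩
    - (suc m ×ᴿ 1#) + - (suc n ×ᴿ 1#)     ∎

  -‿homo : ∀ i → ⟦ ℤ.- i ⟧ℤ ≈ - ⟦ i ⟧ℤ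
  -‿homo (+ zero) = sym -0#≈0#
  -‿homo (+ suc n) = refl
  -‿homo -[1+ n ] = sym (-‿involutive _)

  *-homo-+ : ∀ m j → ⟦ + m ℤ.* j ⟧ℤ ≈ ⟦ + m ⟧ℤ * ⟦ j ⟧ℤ
  *-homo-+ m (+ n) = begin
    ⟦ + m ℤ.* + n ⟧ℤ    ≡⟨ ≡.cong ⟦_⟧ℤ (≡.sym (ℤ.pos-* m n)) ⟩
    (m ℕ.* n) ×ᴿ 1#      ≈⟨ ×1-homo-* m n ⟩
    m ×ᴿ 1# * n ×ᴿ 1#     ∎
  *-homo-+ m -[1+ n ] = begin
    ⟦ + m ℤ.* -[1+ n ] ⟧ℤ        ≡⟨ ≡.cong ⟦_⟧ℤ (≡.sym (ℤ.neg-distribʳ-* (+ m) (+ suc n))) ⟩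
    ⟦ ℤ.- (+ m ℤ.* + suc n) ⟧ℤ   ≈⟨ -‿homo (+ m ℤ.* + suc n) ⟩
    - ⟦ + m ℤ.* + suc n ⟧ℤ       ≈⟨ -‿cong (*-homo-+ m (+ suc n)) ⟩
    - (m ×ᴿ 1# * suc n ×ᴿ 1#)      ≈⟨ -‿distribʳ-* _ _ ⟩
    m ×ᴿ 1# * - (suc n ×ᴿ 1#)      ∎

  *-homo : ∀ i j → ⟦ i ℤ.* j ⟧ℤ ≈ ⟦ i ⟧ℤ * ⟦ j ⟧ℤ
  *-homo (+ m) j = *-homo-+ m j
  *-homo -[1+ m ] j = begin
    ⟦ -[1+ m ] ℤ.* j ⟧ℤ          ≡⟨ ≡.cong ⟦_⟧ℤ (≡.sym (ℤ.neg-distribˡ-* (+ suc m) j)) ⟩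
    ⟦ ℤ.- (+ suc m ℤ.* j) ⟧ℤ     ≈⟨ -‿homo (+ suc m ℤ.* j) ⟩
    - ⟦ + suc m ℤ.* j ⟧ℤ         ≈⟨ -‿cong (*-homo-+ (suc m) j) ⟩
    - (suc m ×ᴿ 1# * ⟦ j ⟧ℤ)      ≈⟨ -‿distribˡ-* _ _ ⟩
    - (suc m ×ᴿ 1#) * ⟦ j ⟧ℤ      ∎

  coefficients : ℤ.+-*-rawRing -Raw-AlmostCommutative⟶ fromCommutativeRing R
  coefficients = record
    { ⟦_⟧    = ⟦_⟧ℤ
    ; +-homo = +-homo
    ; *-homo = *-homo
    ; -‿homo = -‿homo
    ; 0-homo = refl
    ; 1-homo = refl
    }

  equalCoefficients? : WeaklyDecidable (Induced-equivalence coefficients)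
  equalCoefficients? i j = Maybe.map (λ i≡j → reflexive (≡.cong ⟦_⟧ℤ i≡j)) (dec⇒weaklyDec ℤ._≟_ i j)

  open import Algebra.Solver.Ring ℤ.+-*-rawRing (fromCommutativeRing R) coefficients equalCoefficients?
    public using (solve; _:=_; _:+_; _:*_; _:-_; :-_; _:^_; con; Polynomial)

  :0 :1 : ∀ {n} → Polynomial n
  :0 = con (+ 0)
  :1 = con (+ 1)

-- Filtered rings, limits and infinite products

-- Recursive, like `triple`, so that partial sums and products up to such an index unfold in blocks
-- of two or three, and so that residue classes are visible to pattern matching.
double : ℕ → ℕ
double zero    = zero
double (suc n) = suc (suc (double n))

n≤double : ∀ n → n ℕ.≤ double n
n≤double zero    = z≤n
n≤double (suc n) = s≤s (ℕ.m≤n⇒m≤1+n (n≤double n))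

triple : ℕ → ℕ
triple zero    = zero
triple (suc n) = suc (suc (suc (triple n)))

n≤triple : ∀ n → n ℕ.≤ triple n
n≤triple zero    = z≤n
n≤triple (suc n) = s≤s (ℕ.m≤n⇒m≤1+n (ℕ.m≤n⇒m≤1+n (n≤triple n)))

-- V n x reads: x has order at least n.
record Filtration (R : CommutativeRing 0ℓ 0ℓ) : Set₁ where
  open CommutativeRing R
  field
    V         : ℕ → Carrier → Set
    V-resp    : ∀ {n x y} → x ≈ y → V n x → V n y
    V-all     : ∀ x → V 0 x
    V-0#      : ∀ n → V n 0#
    V-+       : ∀ {n x y} → V n x → V n y → V n (x + y)
    V-*       : ∀ {m n x y} → V m x → V n y → V (m ℕ.+ n) (x * y)
    V-anti    : ∀ {m n x} → m ℕ.≤ n → V n x → V m x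
    separated : ∀ {x} → (∀ n → V n x) → x ≈ 0#

module Limits {R : CommutativeRing 0ℓ 0ℓ} (F : Filtration R) where
  open CommutativeRing R hiding (zero)
  open Filtration F
  open RingSolving R
  open import Algebra.Properties.Semiring.Exp semiring using (_^_)

  V-*ˡ : ∀ {n y} x → V n y → V n (x * y)
  V-*ˡ x = V-* (V-all x)

  V-neg : ∀ {n x} → V n x → V n (- x)
  V-neg {x = x} v = V-resp (solve 1 (λ x → :- :1 :* x := :- x) refl x) (V-*ˡ (- 1#) v)

  V-^ : ∀ {x} → V 1 x → ∀ n → V n (x ^ n)
  V-^ v zero    = V-all _
  V-^ v (suc n) = V-* v (V-^ v n)

  infix 4 _≈[_]_
  _≈[_]_ : Carrier → ℕ → Carrier → Set
  x ≈[ n ] y = V n (x - y)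

  ≈⇒≈[] : ∀ {n x y} → x ≈ y → x ≈[ n ] y
  ≈⇒≈[] {n} {x} {y} e = V-resp (sym (trans (+-congʳ e) (-‿inverseʳ y))) (V-0# n)

  ≈[]-sym : ∀ {n x y} → x ≈[ n ] y → y ≈[ n ] x
  ≈[]-sym {x = x} {y} v = V-resp (solve 2 (λ x y → :- (x :- y) := y :- x) refl x y) (V-neg v)

  ≈[]-trans : ∀ {n x y z} → x ≈[ n ] y → y ≈[ n ] z → x ≈[ n ] z
  ≈[]-trans {x = x} {y} {z} v w =
    V-resp (solve 3 (λ x y z → (x :- y) :+ (y :- z) := x :- z) refl x y z) (V-+ v w)

  ≈[]-+ : ∀ {n x y z t} → x ≈[ n ] y → z ≈[ n ] t → x + z ≈[ n ] y + t
  ≈[]-+ {x = x} {y} {z} {t} v w =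
    V-resp (solve 4 (λ x y z t → (x :- y) :+ (z :- t) := x :+ z :- (y :+ t)) refl x y z t) (V-+ v w)

  ≈[]-* : ∀ {n x y z t} → x ≈[ n ] y → z ≈[ n ] t → x * z ≈[ n ] y * t
  ≈[]-* {x = x} {y} {z} {t} v w =
    V-resp (solve 4 (λ x y z t → z :* (x :- y) :+ y :* (z :- t) := x :* z :- y :* t) refl x y z t)
      (V-+ (V-*ˡ z v) (V-*ˡ y w))

  -- Modulo V 1 the element x is 1, so it acts invertibly on every quotient by V n.
  V-cancel : ∀ {n x y} → x ≈[ 1 ] 1# → V n (x * y) → V n y
  V-cancel {n} {x} {y} u v = go n ℕ.≤-refl
    where
    go : ∀ m → m ℕ.≤ n → V m y
    go zero    _   = V-all y
    go (suc m) m<n = V-resp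
      (solve 2 (λ x y → x :* y :+ :- ((x :- :1) :* y) := y) refl x y)
      (V-+ (V-anti m<n v) (V-neg (V-* u (go m (ℕ.<⇒≤ m<n)))))

  infix 4 _⟶_
  _⟶_ : (ℕ → Carrier) → Carrier → Set
  s ⟶ x = ∀ L → ∃[ N ] (∀ n → N ℕ.≤ n → s n ≈[ L ] x)

  limit-unique : ∀ {s x y} → s ⟶ x → s ⟶ y → x ≈ y
  limit-unique {s} {x} {y} l m = begin
    x            ≈⟨ solve 2 (λ x y → x := (x :- y) :+ y) refl x y ⟩
    (x - y) + y  ≈⟨ +-congʳ (separated close) ⟩
    0# + y       ≈⟨ +-identityˡ y ⟩
    y            ∎
    where
    open import Relation.Binary.Reasoning.Setoid setoid
    close : ∀ L → x ≈[ L ] y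
    close L with l L | m L
    ... | N , p | M , r =
      ≈[]-trans (≈[]-sym (p (N ℕ.⊔ M) (ℕ.m≤m⊔n N M))) (r (N ℕ.⊔ M) (ℕ.m≤n⊔m N M))

  ⟶-const : ∀ x → (λ _ → x) ⟶ x
  ⟶-const x L = 0 , λ _ _ → ≈⇒≈[] refl

  ⟶-resp : ∀ {s t x} → (∀ n → s n ≈ t n) → s ⟶ x → t ⟶ x
  ⟶-resp e l L with l L
  ... | N , p = N , λ n N≤n → ≈[]-trans (≈⇒≈[] (sym (e n))) (p n N≤n)

  ⟶-+ : ∀ {s t x y} → s ⟶ x → t ⟶ y → (λ n → s n + t n) ⟶ x + y
  ⟶-+ l m L with l L | m L
  ... | N , p | M , r = N ℕ.⊔ M , λ n b →
    ≈[]-+ (p n (ℕ.≤-trans (ℕ.m≤m⊔n N M) b)) (r n (ℕ.≤-trans (ℕ.m≤n⊔m N M) b))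

  ⟶-* : ∀ {s t x y} → s ⟶ x → t ⟶ y → (λ n → s n * t n) ⟶ x * y
  ⟶-* l m L with l L | m L
  ... | N , p | M , r = N ℕ.⊔ M , λ n b →
    ≈[]-* (p n (ℕ.≤-trans (ℕ.m≤m⊔n N M) b)) (r n (ℕ.≤-trans (ℕ.m≤n⊔m N M) b))

  ⟶-subseq : ∀ {s x} (φ : ℕ → ℕ) → (∀ n → n ℕ.≤ φ n) → s ⟶ x → (λ n → s (φ n)) ⟶ x
  ⟶-subseq φ φ≥ l L with l L
  ... | N , p = N , λ n N≤n → p (φ n) (ℕ.≤-trans N≤n (φ≥ n))

  ⟶-close : ∀ {s t x} → (∀ L → ∃[ N ] (∀ n → N ℕ.≤ n → t n ≈[ L ] s n)) → s ⟶ x → t ⟶ x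
  ⟶-close c l L with c L | l L
  ... | N , p | M , r = N ℕ.⊔ M , λ n b →
    ≈[]-trans (p n (ℕ.≤-trans (ℕ.m≤m⊔n N M) b)) (r n (ℕ.≤-trans (ℕ.m≤n⊔m N M) b))

  Σ< : (ℕ → Carrier) → ℕ → Carrier
  Σ< u zero    = 0#
  Σ< u (suc n) = Σ< u n + u n

  Π< : (ℕ → Carrier) → ℕ → Carrier
  Π< u zero    = 1#
  Π< u (suc n) = Π< u n * u n

  Σ<-*ˡ : ∀ c s n → c * Σ< s n ≈ Σ< (λ i → c * s i) n
  Σ<-*ˡ c s zero    = zeroʳ c
  Σ<-*ˡ c s (suc n) = trans (distribˡ c _ _) (+-congʳ (Σ<-*ˡ c s n))

  Π<-cong : ∀ {u v} → (∀ i → u i ≈ v i) → ∀ n → Π< u n ≈ Π< v n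
  Π<-cong e zero    = refl
  Π<-cong e (suc n) = *-cong (Π<-cong e n) (e n)

  Π<-* : ∀ u v n → Π< (λ i → u i * v i) n ≈ Π< u n * Π< v n
  Π<-* u v zero    = sym (*-identityˡ 1#)
  Π<-* u v (suc n) = trans (*-congʳ (Π<-* u v n))
    (solve 4 (λ a b c d → a :* b :* (c :* d) := a :* c :* (b :* d)) refl _ _ _ _)

  Π<-1 : ∀ n → Π< (λ _ → 1#) n ≈ 1#
  Π<-1 zero    = refl
  Π<-1 (suc n) = trans (*-identityʳ _) (Π<-1 n)

  -- A relation, so that it makes sense without completeness. Identities between infinite products
  -- then follow from equal factors and `limit-unique`.
  HasProduct : (ℕ → Carrier) → Carrier → Set
  HasProduct u x = Π< u ⟶ x

  HasProduct-* : ∀ {u v x y} → HasProduct u x → HasProduct v y →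
                 HasProduct (λ i → u i * v i) (x * y)
  HasProduct-* {u} {v} p r = ⟶-resp (λ n → sym (Π<-* u v n)) (⟶-* p r)

  HasProduct-cong : ∀ {u v x} → (∀ i → u i ≈ v i) → HasProduct u x → HasProduct v x
  HasProduct-cong e = ⟶-resp (Π<-cong e)

  Π<-double : ∀ u n → Π< (λ i → u (double i) * u (suc (double i))) n ≈ Π< u (double n)
  Π<-double u zero    = refl
  Π<-double u (suc n) = trans (*-congʳ (Π<-double u n)) (sym (*-assoc _ _ _))

  HasProduct-double : ∀ {u x} → HasProduct u x →
                      HasProduct (λ i → u (double i) * u (suc (double i))) x
  HasProduct-double {u} p = ⟶-resp (λ n → sym (Π<-double u n)) (⟶-subseq double n≤double p)

  Π<-triple : ∀ u n → Π< (λ i → u (triple i) * u (suc (triple i)) * u (suc (suc (triple i)))) n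
                      ≈ Π< u (triple n)
  Π<-triple u zero    = refl
  Π<-triple u (suc n) = trans (*-congʳ (Π<-triple u n))
    (solve 4 (λ a b c d → a :* (b :* c :* d) := a :* b :* c :* d) refl _ _ _ _)

  HasProduct-triple : ∀ {u x} → HasProduct u x →
    HasProduct (λ i → u (triple i) * u (suc (triple i)) * u (suc (suc (triple i)))) x
  HasProduct-triple {u} p =
    ⟶-resp (λ n → sym (Π<-triple u n)) (⟶-subseq triple n≤triple p)

  Π<-head : ∀ u n → Π< u (suc n) ≈ u 0 * Π< (λ i → u (suc i)) n
  Π<-head u zero    = *-comm _ _
  Π<-head u (suc n) = trans (*-congʳ (Π<-head u n)) (*-assoc _ _ _)

  ⟶-unsuc : ∀ {s x} → (λ n → s (suc n)) ⟶ x → s ⟶ x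
  ⟶-unsuc {s} {x} l L with l L
  ... | N , p = suc N , λ where (suc n) (s≤s N≤n) → p n N≤n

  HasProduct-head : ∀ {u x} → HasProduct (λ i → u (suc i)) x → HasProduct u (u 0 * x)
  HasProduct-head {u} p = ⟶-unsuc (⟶-resp (λ n → sym (Π<-head u n)) (⟶-* (⟶-const (u 0)) p))

  ⟶-near : ∀ {s x y L} → (∀ n → s n ≈[ L ] y) → s ⟶ x → x ≈[ L ] y
  ⟶-near {L = L} c l with l L
  ... | N , p = ≈[]-trans (≈[]-sym (p N ℕ.≤-refl)) (c N)

  HasProduct-near : ∀ {u x L} → (∀ i → u i ≈[ L ] 1#) → HasProduct u x → x ≈[ L ] 1#
  HasProduct-near {u} {L = L} c = ⟶-near go
    where
    go : ∀ n → Π< u n ≈[ L ] 1#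
    go zero    = ≈⇒≈[] refl
    go (suc n) = ≈[]-trans (≈[]-* (go n) (c n)) (≈⇒≈[] (*-identityˡ 1#))

-- The prescribed rate makes the limit of power series simply the diagonal. Dual numbers need no
-- instance: their limits are paired from limits of the components.
record Complete {R : CommutativeRing 0ℓ 0ℓ} (F : Filtration R) : Set where
  open CommutativeRing R using (Carrier)
  open Limits F
  field
    lim      : (ℕ → Carrier) → Carrier
    complete : ∀ {s} → (∀ n → s (suc n) ≈[ suc n ] s n) → s ⟶ lim s

-- Jacobi's triple product from its finite form

module Theta {R : CommutativeRing 0ℓ 0ℓ} (F : Filtration R) where
  open CommutativeRing R hiding (zero)
  open Filtration F
  open Limits F
  open RingSolving R
  open import Algebra.Properties.Semiring.Exp semiring using (_^_; ^-homo-*; ^-congʳ; ^-congˡ)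
  open import Relation.Binary.Reasoning.Setoid setoid

  module Binomials (Q : Carrier) where
    poch : ℕ → Carrier
    poch = Π< (λ i → 1# - Q ^ suc i)

    -- binom N n is the Gaussian binomial coefficient [ 2N , N + n ] in base Q; the recursion
    -- is the one imposed by the factors (1 + a Q^N)(1 + b Q^N) in finiteTripleProduct.
    binom : ℕ → ℕ → Carrier
    binom zero    zero    = 1#
    binom zero    (suc n) = 0#
    binom (suc N) zero    = (1# + Q ^ suc (N ℕ.+ N)) * binom N 0 + (1# + 1#) *
        (Q ^ suc N * binom N 1)
    binom (suc N) (suc n) = (1# + Q ^ suc (N ℕ.+ N)) * binom N (suc n)
      + (Q ^ (N ℕ.∸ n) * binom N n + Q ^ suc (suc (N ℕ.+ n)) * binom N (suc (suc n)))

    binom-zero : ∀ {N n} → N ℕ.< n → binom N n ≈ 0#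
    binom-zero {zero}  {suc n} _ = refl
    binom-zero {suc N} {suc n} (s≤s N<n) = begin
      _ ≈⟨ +-cong (*-congˡ (binom-zero (ℕ.m<n⇒m<1+n N<n)))
             (+-cong (*-congˡ (binom-zero N<n))
                     (*-congˡ (binom-zero (ℕ.m<n⇒m<1+n (ℕ.m<n⇒m<1+n N<n))))) ⟩
      _ ≈⟨ solve 3 (λ x y z → x :* :0 :+ (y :* :0 :+ z :* :0) := :0) refl _ _ _ ⟩
      0# ∎

    mutual
      -- The factorial formula for the Gaussian binomial, with d = N - n and the denominators
      -- cleared because the ring has no division.
      binom-closed : ∀ N n d → n ℕ.+ d ≡.≡ N → binom N n * (poch d * poch (N ℕ.+ n)) ≈ poch
          (N ℕ.+ N)
      binom-closed zero zero d ≡.refl = solve 0 (:1 :* (:1 :* :1) := :1) refl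
      binom-closed (suc N) zero _ ≡.refl = begin
        binom (suc N) 0 * (poch (suc N) * poch (suc N ℕ.+ 0))
          ≡⟨ ≡.cong (λ k → binom (suc N) 0 * (poch (suc N) * poch (suc k))) (ℕ.+-identityʳ N) ⟩
        binom (suc N) 0 * (poch (suc N) * poch (suc N))
          ≈⟨ *-congʳ (+-cong (*-congʳ (+-congˡ (*-congˡ (^-homo-* Q N N)))) refl) ⟩
        ((1# + Q * (A * A)) * binom N 0 + (1# + 1#) * (Q * A * binom N 1)) *
            (poch N * (1# - Q * A) * (poch N * (1# - Q * A)))
          ≈⟨ solve 5 (λ q a x y p →
               ((:1 :+ q :* (a :* a)) :* x :+ (:1 :+ :1) :* (q :* a :* y)) :*
                   (p :* (:1 :- q :* a) :* (p :* (:1 :- q :* a)))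
               := (:1 :+ q :* (a :* a)) :* (x :* (p :* p)) :* ((:1 :- q :* a) :* (:1 :- q :* a))
                   :+ (:1 :+ :1) :* q :* a :* (y :* (p :* (p :* (:1 :- q :* a)))) :* (:1 :- q :* a))
                       refl Q A (binom N 0) (binom N 1) (poch N) ⟩
        (1# + Q * (A * A)) * (binom N 0 * (poch N * poch N)) * ((1# - Q * A) * (1# - Q * A))
          + (1# + 1#) * Q * A * (binom N 1 * (poch N * (poch N * (1# - Q * A)))) * (1# - Q * A)
          ≈⟨ +-cong (*-congʳ (*-congˡ here)) (*-congʳ (*-congˡ above)) ⟩
        (1# + Q * (A * A)) * poch (N ℕ.+ N) * ((1# - Q * A) * (1# - Q * A))
          + (1# + 1#) * Q * A * (poch (N ℕ.+ N) * (1# - A)) * (1# - Q * A)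
          ≈⟨ solve 3 (λ q a p →
               (:1 :+ q :* (a :* a)) :* p :* ((:1 :- q :* a) :* (:1 :- q :* a))
                 :+ (:1 :+ :1) :* q :* a :* (p :* (:1 :- a)) :* (:1 :- q :* a)
               := p :* (:1 :- q :* (a :* a)) :* (:1 :- q :* (q :* (a :* a))))
                   refl Q A (poch (N ℕ.+ N)) ⟩
        poch (N ℕ.+ N) * (1# - Q * (A * A)) * (1# - Q * (Q * (A * A)))
          ≈⟨ *-cong (*-congˡ (+-congˡ (-‿cong (*-congˡ (^-homo-* Q N N)))))
                    (+-congˡ (-‿cong (*-congˡ (*-congˡ (^-homo-* Q N N))))) ⟨
        poch (suc (suc (N ℕ.+ N)))
          ≡⟨ ≡.cong (λ k → poch (suc k)) (ℕ.+-suc N N) ⟨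
        poch (suc N ℕ.+ suc N) ∎
        where
        A = Q ^ N
        here : binom N 0 * (poch N * poch N) ≈ poch (N ℕ.+ N)
        here = trans (*-congˡ (*-congˡ (reflexive (≡.cong poch (≡.sym (ℕ.+-identityʳ N))))))
                     (binom-closed N 0 N ≡.refl)
        above : binom N 1 * (poch N * poch (suc N)) ≈ poch (N ℕ.+ N) * (1# - A)
        above = trans (*-congˡ (*-congˡ
            (reflexive (≡.cong (λ k → poch (suc k)) (≡.sym (ℕ.+-identityʳ N))))))
                      (binom-next N 0 N ≡.refl)
      -- Here n = N, so of the three old coefficients in the recursion only `binom N n` survives.
      binom-closed (suc N) (suc n) zero e = begin
        ((1# + Q ^ suc (N ℕ.+ N)) * binom N (suc n) +
            (Q ^ (N ℕ.∸ n) * binom N n + Q ^ suc (suc (N ℕ.+ n)) * binom N (suc (suc n))))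
          * (1# * poch (suc (N ℕ.+ suc n)))
          ≈⟨ *-congʳ (+-cong (*-congˡ (binom-zero (s≤s (ℕ.≤-reflexive N≡n))))
               (+-cong (*-congʳ (^-congʳ Q (≡.trans (≡.cong (N ℕ.∸_) (≡.sym N≡n)) (ℕ.n∸n≡0 N))))
                       (*-congˡ (binom-zero (s≤s (ℕ.m≤n⇒m≤1+n (ℕ.≤-reflexive N≡n))))))) ⟩
        ((1# + Q ^ suc (N ℕ.+ N)) * 0# + (1# * binom N n + Q ^ suc (suc (N ℕ.+ n)) * 0#))
          * (1# * poch (suc (N ℕ.+ suc n)))
          ≡⟨ ≡.cong (λ k → ((1# + Q ^ suc (N ℕ.+ N)) * 0# +
              (1# * binom N n + Q ^ suc (suc (N ℕ.+ n)) * 0#)) * (1# * poch (suc k)))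
              (ℕ.+-suc N n) ⟩
        ((1# + Q ^ suc (N ℕ.+ N)) * 0# + (1# * binom N n + Q ^ suc (suc (N ℕ.+ n)) * 0#))
          * (1# * (poch (N ℕ.+ n) * (1# - Q ^ suc (N ℕ.+ n)) * (1# - Q ^ suc (suc (N ℕ.+ n)))))
          ≈⟨ solve 6 (λ u v x p s t → (u :* :0 :+ (:1 :* x :+ v :* :0)) :* (:1 :* (p :* s :* t))
              := x :* (:1 :* p) :* s :* t) refl _ _ _ _ _ _ ⟩
        binom N n * (1# * poch (N ℕ.+ n)) * (1# - Q ^ suc (N ℕ.+ n)) *
            (1# - Q ^ suc (suc (N ℕ.+ n)))
          ≈⟨ *-congʳ (*-congʳ (binom-closed N n 0 (ℕ.suc-injective e))) ⟩
        poch (N ℕ.+ N) * (1# - Q ^ suc (N ℕ.+ n)) * (1# - Q ^ suc (suc (N ℕ.+ n)))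
          ≡⟨ ≡.cong (λ k → poch (N ℕ.+ N) * (1# - Q ^ suc (N ℕ.+ k)) *
              (1# - Q ^ suc (suc (N ℕ.+ k)))) (≡.sym N≡n) ⟩
        poch (suc (suc (N ℕ.+ N)))
          ≡⟨ ≡.cong (λ k → poch (suc k)) (ℕ.+-suc N N) ⟨
        poch (suc N ℕ.+ suc N) ∎
        where
        N≡n : N ≡.≡ n
        N≡n = ≡.trans (≡.sym (ℕ.suc-injective e)) (ℕ.+-identityʳ n)
      binom-closed (suc N) (suc n) (suc d) e = begin
        ((1# + Q ^ suc (N ℕ.+ N)) * X₁ + (Q ^ (N ℕ.∸ n) * X₀ + Q ^ suc (suc (N ℕ.+ n)) * X₂))
          * (poch (suc d) * poch (suc (N ℕ.+ suc n)))
          ≡⟨ ≡.cong₂ (λ k l → ((1# + Q ^ suc (N ℕ.+ N)) * X₁ +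
              (Q ^ k * X₀ + Q ^ suc (suc (N ℕ.+ n)) * X₂))
                         * (poch (suc d) * poch (suc l))) N∸n (ℕ.+-suc N n) ⟩
        ((1# + Q ^ suc (N ℕ.+ N)) * X₁ + (Q * A * X₀ + Q * (Q * B) * X₂))
          * (D * (1# - Q * A) * (E * (1# - Q * B) * (1# - Q * (Q * B))))
          ≈⟨ *-congʳ (+-congʳ (*-congʳ (+-congˡ Q^2N))) ⟩
        ((1# + Q * (Q * (A * B))) * X₁ + (Q * A * X₀ + Q * (Q * B) * X₂))
          * (D * (1# - Q * A) * (E * (1# - Q * B) * (1# - Q * (Q * B))))
          ≈⟨ solve 8 (λ q a b x₀ x₁ x₂ d e →
               ((:1 :+ q :* (q :* (a :* b))) :* x₁ :+ (q :* a :* x₀ :+ q :* (q :* b) :* x₂))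
                 :* (d :* (:1 :- q :* a) :* (e :* (:1 :- q :* b) :* (:1 :- q :* (q :* b))))
               := (:1 :+ q :* (q :* (a :* b))) :* (:1 :- q :* (q :* b)) :*
                   (x₁ :* ((d :* (:1 :- q :* a)) :* (e :* (:1 :- q :* b))))
                  :+ (q :* a :* (:1 :- q :* b) :* (:1 :- q :* (q :* b)) :*
                      (x₀ :* (d :* (:1 :- q :* a) :* e))
                  :+ q :* (q :* b) :* (:1 :- q :* a) :*
                      (x₂ :* (d :* (e :* (:1 :- q :* b) :* (:1 :- q :* (q :* b)))))))
               refl Q A B X₀ X₁ X₂ D E ⟩
        (1# + Q * (Q * (A * B))) * (1# - Q * (Q * B)) * (X₁ * (poch (suc d) * poch (suc (N ℕ.+ n))))
          + (Q * A * (1# - Q * B) * (1# - Q * (Q * B)) * (X₀ * (poch (suc d) * E))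
          + Q * (Q * B) * (1# - Q * A) * (X₂ * (D * poch (suc (suc (N ℕ.+ n))))))
          ≈⟨ +-cong (*-congˡ (binom-next N n (suc d) e′))
               (+-cong (*-congˡ (binom-closed N n (suc d) e′)) (*-congˡ above)) ⟩
        (1# + Q * (Q * (A * B))) * (1# - Q * (Q * B)) * (P * (1# - Q * A))
          + (Q * A * (1# - Q * B) * (1# - Q * (Q * B)) * P
          + Q * (Q * B) * (1# - Q * A) * (P * (1# - A)))
          ≈⟨ solve 4 (λ q a b p →
               (:1 :+ q :* (q :* (a :* b))) :* (:1 :- q :* (q :* b)) :* (p :* (:1 :- q :* a))
                 :+ (q :* a :* (:1 :- q :* b) :* (:1 :- q :* (q :* b)) :* p
                 :+ q :* (q :* b) :* (:1 :- q :* a) :* (p :* (:1 :- a)))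
               := p :* (:1 :- q :* (q :* (a :* b))) :* (:1 :- q :* (q :* (q :* (a :* b)))))
                   refl Q A B P ⟩
        P * (1# - Q * (Q * (A * B))) * (1# - Q * (Q * (Q * (A * B))))
          ≈⟨ *-cong (*-congˡ (+-congˡ (-‿cong Q^2N))) (+-congˡ (-‿cong (*-congˡ Q^2N))) ⟨
        poch (suc (suc (N ℕ.+ N)))
          ≡⟨ ≡.cong (λ k → poch (suc k)) (ℕ.+-suc N N) ⟨
        poch (suc N ℕ.+ suc N) ∎
        where
        A = Q ^ d
        B = Q ^ (N ℕ.+ n)
        D = poch d
        E = poch (N ℕ.+ n)
        P = poch (N ℕ.+ N)
        X₀ = binom N n
        X₁ = binom N (suc n)
        X₂ = binom N (suc (suc n))
        e′ : n ℕ.+ suc d ≡.≡ N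
        e′ = ℕ.suc-injective e
        N∸n : N ℕ.∸ n ≡.≡ suc d
        N∸n = ≡.trans (≡.cong (ℕ._∸ n) (≡.sym e′)) (ℕ.m+n∸m≡n n (suc d))
        2N : suc (N ℕ.+ N) ≡.≡ suc (suc (d ℕ.+ (N ℕ.+ n)))
        2N = ≡.trans (≡.cong (λ k → suc (N ℕ.+ k)) (≡.sym e′)) (arith N n d)
          where
          arith : ∀ N n d → suc (N ℕ.+ (n ℕ.+ suc d)) ≡.≡ suc (suc (d ℕ.+ (N ℕ.+ n)))
          arith = ℕSolver.solve-∀
        Q^2N : Q ^ suc (N ℕ.+ N) ≈ Q * (Q * (A * B))
        Q^2N = trans (^-congʳ Q 2N) (*-congˡ (*-congˡ (^-homo-* Q d (N ℕ.+ n))))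
        above : X₂ * (D * poch (suc (suc (N ℕ.+ n)))) ≈ P * (1# - A)
        above = trans (*-congˡ (*-congˡ
            (reflexive (≡.cong (λ k → poch (suc k)) (≡.sym (ℕ.+-suc N n))))))
                      (binom-next N (suc n) d (≡.trans (≡.sym (ℕ.+-suc n d)) e′))

      -- The closed form at n + 1, still written with d = N - n. The factor 1 - Q^d vanishes at d =
      -- 0, exactly where n + 1 exceeds N, so the induction can use it without separating that
      -- boundary.
      binom-next : ∀ N n d → n ℕ.+ d ≡.≡ N →
        binom N (suc n) * (poch d * poch (suc (N ℕ.+ n))) ≈ poch (N ℕ.+ N) * (1# - Q ^ d)
      binom-next N n zero e = begin
        binom N (suc n) * (1# * poch (suc (N ℕ.+ n)))
          ≈⟨ *-congʳ (binom-zero (s≤s (ℕ.≤-reflexive (≡.trans (≡.sym e) (ℕ.+-identityʳ n))))) ⟩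
        0# * (1# * poch (suc (N ℕ.+ n)))
          ≈⟨ solve 2 (λ x y → :0 :* (:1 :* x) := y :* (:1 :- :1)) refl _ _ ⟩
        poch (N ℕ.+ N) * (1# - 1#) ∎
      binom-next N n (suc d) e = begin
        binom N (suc n) * (poch d * (1# - Q ^ suc d) * poch (suc (N ℕ.+ n)))
          ≈⟨ solve 4 (λ x y z t → x :* (y :* z :* t) := x :* (y :* t) :* z) refl _ _ _ _ ⟩
        binom N (suc n) * (poch d * poch (suc (N ℕ.+ n))) * (1# - Q ^ suc d)
          ≡⟨ ≡.cong (λ k → binom N (suc n) * (poch d * poch k) * (1# - Q ^ suc d))
              (≡.sym (ℕ.+-suc N n)) ⟩
        binom N (suc n) * (poch d * poch (N ℕ.+ suc n)) * (1# - Q ^ suc d)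
          ≈⟨ *-congʳ (binom-closed N (suc n) d (≡.trans (≡.sym (ℕ.+-suc n d)) e)) ⟩
        poch (N ℕ.+ N) * (1# - Q ^ suc d) ∎

    V-poch : V 1 Q → ∀ {L} n → L ℕ.≤ n → poch n ≈[ L ] poch L
    V-poch v {L} n L≤n with ℕ.≤⇒≤′ L≤n
    ... | p = go p
      where
      go : ∀ {n} → L ℕ.≤′ n → poch n ≈[ L ] poch L
      go ℕ.≤′-refl = ≈⇒≈[] refl
      go (ℕ.≤′-step {n} p) = ≈[]-trans
        (V-resp (solve 2 (λ x y → :- (x :* y) := x :* (:1 :- y) :- x) refl _ _)
          (V-neg (V-*ˡ (poch n) (V-anti (ℕ.m≤n⇒m≤1+n (ℕ.≤′⇒≤ p)) (V-^ v (suc n))))))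
        (go p)

    poch-unit : V 1 Q → ∀ n → poch n ≈[ 1 ] 1#
    poch-unit v zero    = ≈⇒≈[] refl
    poch-unit v (suc n) = V-resp (solve 2 (λ x y → (x :- :1) :+ :- (x :* y) := x :* (:1 :- y) :- :1)
        refl _ _)
      (V-+ (poch-unit v n) (V-neg (V-*ˡ (poch n) (V-anti (s≤s z≤n) (V-^ v (suc n))))))

    -- To order L every `poch m` with L ≤ m agrees with E = `poch L`. The closed form becomes binom
    -- · E · E ≈ E, and E, being 1 modulo order 1, can be cancelled.
    poch-binom : V 1 Q → ∀ {L} N n → n ℕ.+ L ℕ.≤ N → poch N * binom N n ≈[ L ] 1#
    poch-binom v {L} N n n+L≤N = ≈[]-trans (≈[]-* (V-poch v N (ℕ.m+n≤o⇒n≤o n n+L≤N)) (≈⇒≈[] refl))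
      (V-cancel (poch-unit v L)
        (V-resp (solve 2 (λ e b → b :* (e :* e) :- e := e :* (e :* b :- :1))
            refl (poch L) (binom N n))
          (≈[]-trans
            (≈[]-* (≈⇒≈[] refl) (≈[]-* (≈[]-sym (V-poch v (N ℕ.∸ n) L≤d))
                (≈[]-sym (V-poch v (N ℕ.+ n) (ℕ.m≤n⇒m≤n+o n L≤N)))))
            (≈[]-trans (≈⇒≈[] (binom-closed N n (N ℕ.∸ n) (ℕ.m+[n∸m]≡n (ℕ.m+n≤o⇒m≤o n n+L≤N))))
              (V-poch v (N ℕ.+ N) (ℕ.m≤n⇒m≤n+o N L≤N))))))
      where
      L≤N = ℕ.m+n≤o⇒n≤o n n+L≤N
      L≤d : L ℕ.≤ N ℕ.∸ n
      L≤d = ℕ.m+n≤o⇒m≤o∸n L (ℕ.≤-trans (ℕ.≤-reflexive (ℕ.+-comm L n)) n+L≤N)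

  -- w a b n = a^(n(n+1)/2) b^(n(n-1)/2) and w b a n are the terms of index n and -n of f(a,b).
  w : Carrier → Carrier → ℕ → Carrier
  w a b zero    = 1#
  w a b (suc n) = w a b n * (a * (a * b) ^ n)

  thetaTerm : Carrier → Carrier → ℕ → Carrier
  thetaTerm a b zero    = 1#
  thetaTerm a b (suc n) = w a b (suc n) + w b a (suc n)

  thetaSum : Carrier → Carrier → ℕ → Carrier
  thetaSum a b n = Σ< (thetaTerm a b) (suc n)

  thetaFactor : Carrier → Carrier → ℕ → Carrier
  thetaFactor a b i = (1# + a * (a * b) ^ i) * (1# + b * (a * b) ^ i) * (1# - (a * b) ^ suc i)

  IsTheta : Carrier → Carrier → Carrier → Set
  IsTheta a b = HasProduct (thetaFactor a b)

  module TripleProduct (a b : Carrier) where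
    private Q = a * b
    open Binomials Q

    finiteProduct : ℕ → Carrier
    finiteProduct = Π< (λ i → (1# + a * Q ^ i) * (1# + b * Q ^ i))

    w+w : ℕ → Carrier
    w+w n = w a b n + w b a n

    Q^ba : ∀ n → (b * a) ^ n ≈ Q ^ n
    Q^ba n = ^-congˡ n (*-comm b a)

    -- On `w a b (suc m)` the factor a Q^(m+1) raises the index by one, while b Q^(m+1) lowers it at
    -- the cost of Q^(2m+2). On `w b a` the roles are exchanged.
    w+w-recurrence : ∀ m → (a + b) * Q ^ suc m * w+w (suc m) ≈ w+w (suc (suc m)) + Q ^ suc m * Q ^
        suc m * w+w m
    w+w-recurrence m = begin
      (a + b) * Q ^ suc m * w+w (suc m)
        ≈⟨ *-congˡ (+-congˡ (*-congˡ (*-congˡ (Q^ba m)))) ⟩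
      (a + b) * (a * b * p) * (x * (a * p) + y * (b * p))
        ≈⟨ solve 5 (λ a b p x y → (a :+ b) :* (a :* b :* p) :* (x :* (a :* p) :+ y :* (b :* p))
             := (x :* (a :* p) :* (a :* (a :* b :* p)) :+ y :* (b :* p) :* (b :* (a :* b :* p)))
                :+ a :* b :* p :* (a :* b :* p) :* (x :+ y)) refl a b p x y ⟩
      (x * (a * p) * (a * (a * b * p)) + y * (b * p) * (b * (a * b * p))) + Q ^ suc m * Q ^ suc m *
          w+w m
        ≈⟨ +-congʳ (+-congˡ (*-cong (*-congˡ (*-congˡ (Q^ba m))) (*-congˡ (Q^ba (suc m))))) ⟨
      w+w (suc (suc m)) + Q ^ suc m * Q ^ suc m * w+w m ∎
      where
      p = Q ^ m
      x = w a b m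
      y = w b a m

    factor-expand : ∀ N → (1# + a * Q ^ N) * (1# + b * Q ^ N) ≈ 1# + Q ^ suc (N ℕ.+ N) + (a + b) * Q
        ^ N
    factor-expand N = begin
      (1# + a * Q ^ N) * (1# + b * Q ^ N)
        ≈⟨ solve 3 (λ a b p → (:1 :+ a :* p) :* (:1 :+ b :* p)
            := :1 :+ a :* b :* (p :* p) :+ (a :+ b) :* p) refl a b (Q ^ N) ⟩
      1# + a * b * (Q ^ N * Q ^ N) + (a + b) * Q ^ N
        ≈⟨ +-congʳ (+-congˡ (*-congˡ (^-homo-* Q N N))) ⟨
      1# + Q ^ suc (N ℕ.+ N) + (a + b) * Q ^ N ∎

    -- The telescoped correction terms of the induction on N.
    up down : ℕ → ℕ → Carrier
    up   N n = Q ^ (N ℕ.∸ n) * w+w (suc n) * binom N n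
    down N n = Q ^ suc (N ℕ.+ n) * w+w n * binom N (suc n)

    term-step : ∀ N n → thetaTerm a b (suc n) * binom (suc N) (suc n)
      ≈ (1# + Q ^ suc (N ℕ.+ N)) * (thetaTerm a b (suc n) * binom N (suc n)) + up N n + down N
          (suc n)
    term-step N n = trans
      (solve 7 (λ t u x y z p r → t :* ((:1 :+ u) :* x :+ (p :* y :+ r :* z))
         := (:1 :+ u) :* (t :* x) :+ p :* t :* y :+ r :* t :* z) refl
         (w+w (suc n)) (Q ^ suc (N ℕ.+ N)) (binom N (suc n)) (binom N n) (binom N (suc (suc n)))
             (Q ^ (N ℕ.∸ n)) (Q ^ suc (suc (N ℕ.+ n))))
      (+-congˡ (*-congʳ (*-congʳ (^-congʳ Q (≡.cong suc (≡.sym (ℕ.+-suc N n)))))))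

    shift-step : ∀ N n → suc n ℕ.≤ N →
      (a + b) * Q ^ N * (thetaTerm a b (suc n) * binom N (suc n)) ≈ up N (suc n) + down N n
    shift-step N n n<N = begin
      (a + b) * Q ^ N * (w+w (suc n) * binom N (suc n))
        ≈⟨ *-congʳ (*-congˡ Q^N) ⟩
      (a + b) * (r * Q ^ suc n) * (w+w (suc n) * binom N (suc n))
        ≈⟨ solve 5 (λ k r p t x → k :* (r :* p) :* (t :* x) := r :* (k :* p :* t) :* x)
            refl _ _ _ _ _ ⟩
      r * ((a + b) * Q ^ suc n * w+w (suc n)) * binom N (suc n)
        ≈⟨ *-congʳ (*-congˡ (w+w-recurrence n)) ⟩
      r * (w+w (suc (suc n)) + Q ^ suc n * Q ^ suc n * w+w n) * binom N (suc n)
        ≈⟨ solve 5 (λ r t p u x → r :* (t :+ p :* p :* u) :* x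
            := r :* t :* x :+ (r :* p) :* p :* u :* x) refl _ _ _ _ _ ⟩
      up N (suc n) + r * Q ^ suc n * Q ^ suc n * w+w n * binom N (suc n)
        ≈⟨ +-congˡ (*-congʳ (*-congʳ (trans (*-congʳ (sym Q^N))
            (trans (sym (^-homo-* Q N (suc n))) (^-congʳ Q (ℕ.+-suc N n)))))) ⟩
      up N (suc n) + down N n ∎
      where
      r = Q ^ (N ℕ.∸ suc n)
      Q^N : Q ^ N ≈ r * Q ^ suc n
      Q^N = trans (^-congʳ Q (≡.sym (ℕ.m∸n+n≡m n<N))) (^-homo-* Q (N ℕ.∸ suc n) (suc n))

    -- Multiplication by (a + b) Q^N moves every term to the two neighbouring indices. Across the
    -- cut between n and n + 1, `up N n` is what leaves the partial sum and `down N n` is what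
    -- enters it.
    telescoped : ∀ N n → n ℕ.≤ N →
      Σ< (λ i → thetaTerm a b i * binom (suc N) i) (suc n) + up N n
        ≈ (1# + Q ^ suc (N ℕ.+ N) + (a + b) * Q ^ N) * Σ< (λ i → thetaTerm a b i * binom N i)
            (suc n) + down N n
    telescoped N zero _ = trans
      (+-congˡ (*-congʳ (*-congˡ (+-cong (solve 1 (λ a → :1 :* (a :* :1) := a) refl a)
          (solve 1 (λ a → :1 :* (a :* :1) := a) refl b)))))
      (trans (solve 6 (λ k u p x r y →
                (:0 :+ :1 :* ((:1 :+ u) :* x :+ (:1 :+ :1) :* (r :* y))) :+ p :* k :* x
                := (:1 :+ u :+ k :* p) :* (:0 :+ :1 :* x) :+ r :* (:1 :+ :1) :* y) refl
                (a + b) (Q ^ suc (N ℕ.+ N)) (Q ^ N) (binom N 0) (Q ^ suc N) (binom N 1))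
        (+-congˡ (*-congʳ (*-congʳ (^-congʳ Q (≡.cong suc (≡.sym (ℕ.+-identityʳ N))))))))
    telescoped N (suc n) n<N = begin
      S′ + thetaTerm a b (suc n) * binom (suc N) (suc n) + up N (suc n)
        ≈⟨ +-congʳ (+-congˡ (term-step N n)) ⟩
      S′ + (u * T + up N n + down N (suc n)) + up N (suc n)
        ≈⟨ solve 5 (λ s t p d p′ → s :+ (t :+ p :+ d) :+ p′ := (s :+ p) :+ t :+ d :+ p′)
            refl _ _ _ _ _ ⟩
      (S′ + up N n) + u * T + down N (suc n) + up N (suc n)
        ≈⟨ +-congʳ (+-congʳ (+-congʳ (telescoped N n (ℕ.<⇒≤ n<N)))) ⟩
      ((u + k) * S + down N n) + u * T + down N (suc n) + up N (suc n)
        ≈⟨ solve 7 (λ u k s t d d′ p → ((u :+ k) :* s :+ d) :+ u :* t :+ d′ :+ p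
            := (u :+ k) :* s :+ u :* t :+ (p :+ d) :+ d′)
            refl u k S T (down N n) (down N (suc n)) (up N (suc n)) ⟩
      (u + k) * S + u * T + (up N (suc n) + down N n) + down N (suc n)
        ≈⟨ +-congʳ (+-congˡ (sym (shift-step N n n<N))) ⟩
      (u + k) * S + u * T + k * T + down N (suc n)
        ≈⟨ solve 5 (λ u k s t d → (u :+ k) :* s :+ u :* t :+ k :* t :+ d
            := (u :+ k) :* (s :+ t) :+ d) refl _ _ _ _ _ ⟩
      (u + k) * (S + T) + down N (suc n) ∎
      where
      u = 1# + Q ^ suc (N ℕ.+ N)
      k = (a + b) * Q ^ N
      S = Σ< (λ i → thetaTerm a b i * binom N i) (suc n)
      S′ = Σ< (λ i → thetaTerm a b i * binom (suc N) i) (suc n)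
      T = thetaTerm a b (suc n) * binom N (suc n)

    -- Cauchy's finite form of the triple product. In the step from N the cut is placed at n = N:
    -- there `down N N` is zero because `binom N (suc N)` is, and `up N N` is the new top term.
    finiteTripleProduct : ∀ N → finiteProduct N ≈ Σ< (λ i → thetaTerm a b i * binom N i) (suc N)
    finiteTripleProduct zero = solve 0 (:1 := :0 :+ :1 :* :1) refl
    finiteTripleProduct (suc N) = begin
      finiteProduct N * ((1# + a * Q ^ N) * (1# + b * Q ^ N))
        ≈⟨ *-cong (finiteTripleProduct N) (factor-expand N) ⟩
      S * K
        ≈⟨ solve 4 (λ s k r t → s :* k := k :* s :+ r :* t :* :0)
            refl S K (Q ^ suc (N ℕ.+ N)) (w+w N) ⟩
      K * S + Q ^ suc (N ℕ.+ N) * w+w N * 0#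
        ≈⟨ +-congˡ (*-congˡ (binom-zero {N} ℕ.≤-refl)) ⟨
      K * S + down N N
        ≈⟨ telescoped N N ℕ.≤-refl ⟨
      S′ + up N N
        ≈⟨ solve 4 (λ s p u t → s :+ p := s :+ (u :* (t :* :0) :+ p :+ :0))
            refl S′ (up N N) _ (thetaTerm a b (suc N)) ⟩
      S′ + ((1# + Q ^ suc (N ℕ.+ N)) * (thetaTerm a b (suc N) * 0#) + up N N + 0#)
        ≈⟨ +-congˡ (+-cong (+-congʳ (*-congˡ (*-congˡ (binom-zero {N} ℕ.≤-refl))))
             (trans (*-congˡ (binom-zero {N} (ℕ.m<n⇒m<1+n ℕ.≤-refl))) (zeroʳ _))) ⟨
      S′ + ((1# + Q ^ suc (N ℕ.+ N)) * (thetaTerm a b (suc N) * binom N (suc N)) + up N N + down N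
          (suc N))
        ≈⟨ +-congˡ (term-step N N) ⟨
      S′ + thetaTerm a b (suc N) * binom (suc N) (suc N) ∎
      where
      K = 1# + Q ^ suc (N ℕ.+ N) + (a + b) * Q ^ N
      S = Σ< (λ i → thetaTerm a b i * binom N i) (suc N)
      S′ = Σ< (λ i → thetaTerm a b i * binom (suc N) i) (suc N)

    Π<-factor : ∀ N → Π< (thetaFactor a b) N ≈ poch N * finiteProduct N
    Π<-factor N = trans (Π<-* _ _ N) (*-comm _ _)

    module _ (v : V 1 Q) where

      V-thetaTerm : ∀ {L} n → L ℕ.< n → V L (thetaTerm a b n)
      V-thetaTerm (suc n) (s≤s L≤n) = V-anti L≤n
        (V-+ (V-*ˡ _ (V-*ˡ a (V-^ v n))) (V-*ˡ _ (V-*ˡ b (V-resp (sym (Q^ba n)) (V-^ v n)))))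

      V-Σ : ∀ {L} {s t : ℕ → Carrier} n → (∀ i → i ℕ.< n → s i ≈[ L ] t i) → Σ< s n ≈[ L ] Σ< t n
      V-Σ zero    e = ≈⇒≈[] refl
      V-Σ (suc n) e = ≈[]-+ (V-Σ n (λ i i<n → e i (ℕ.m<n⇒m<1+n i<n))) (e n ℕ.≤-refl)

      -- For i + L ≤ N the coefficient `poch N * binom N i` is 1 to order L. For larger i the bound
      -- 2L ≤ N forces L < i, and the theta term itself has order at least L.
      factors-near-terms : ∀ {L} N → L ℕ.+ L ℕ.≤ N → thetaSum a b N ≈[ L ] Π< (thetaFactor a b) N
      factors-near-terms {L} N 2L≤N = ≈[]-sym (≈[]-trans
        (≈⇒≈[] (trans (Π<-factor N) (trans (*-congˡ (finiteTripleProduct N))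
            (Σ<-*ˡ (poch N) _ (suc N)))))
        (V-Σ (suc N) close))
        where
        close : ∀ i → i ℕ.< suc N → poch N * (thetaTerm a b i * binom N i) ≈[ L ] thetaTerm a b i
        close i _ with ℕ.≤-<-connex (i ℕ.+ L) N
        ... | inj₁ i+L≤N = ≈[]-trans
          (≈⇒≈[] (solve 3 (λ p t x → p :* (t :* x) := t :* (p :* x)) refl _ _ _))
          (≈[]-trans (≈[]-* (≈⇒≈[] refl) (poch-binom v N i i+L≤N)) (≈⇒≈[] (*-identityʳ _)))
        ... | inj₂ N<i+L = V-resp (solve 3 (λ p t x → (p :* x :- :1) :* t := p :* (t :* x) :- t)
            refl _ _ _)
          (V-*ˡ _ (V-thetaTerm i (ℕ.+-cancelʳ-< L L i (ℕ.≤-<-trans 2L≤N N<i+L))))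

      -- Only `a * b` has to have positive order. The parameter `a` may be a unit such as -(1 + ε),
      -- as the expansion of f₁³ requires.
      tripleProduct : ∀ {x} → IsTheta a b x → thetaSum a b ⟶ x
      tripleProduct = ⟶-close (λ L → L ℕ.+ L , λ N → factors-near-terms N)

-- Dissections of theta functions modulo 3 and modulo 2

module Dissections {R : CommutativeRing 0ℓ 0ℓ} (F : Filtration R) where
  open CommutativeRing R hiding (zero)
  open Filtration F
  open Limits F
  open Theta F
  open RingSolving R
  open import Algebra.Properties.Semiring.Exp semiring using (_^_; ^-congˡ)
  open import Algebra.Properties.CommutativeSemiring.Exp commutativeSemiring using (^-distrib-*)
  open import Relation.Binary.Reasoning.Setoid setoid

  w-cong : ∀ {a a′ b b′} → a ≈ a′ → b ≈ b′ → ∀ n → w a b n ≈ w a′ b′ n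
  w-cong ea eb zero    = refl
  w-cong ea eb (suc n) = *-cong (w-cong ea eb n) (*-cong ea (^-congˡ n (*-cong ea eb)))

  ^-triple : ∀ x m → x ^ triple m ≈ x ^ m * x ^ m * x ^ m
  ^-triple x zero    = solve 0 (:1 := :1 :* :1 :* :1) refl
  ^-triple x (suc m) = trans (*-congˡ (*-congˡ (*-congˡ (^-triple x m))))
    (solve 2 (λ x y → x :* (x :* (x :* (y :* y :* y))) := x :* y :* (x :* y) :* (x :* y))
        refl x (x ^ m))

  ^-double : ∀ x m → x ^ double m ≈ x ^ m * x ^ m
  ^-double x zero    = solve 0 (:1 := :1 :* :1) refl
  ^-double x (suc m) = trans (*-congˡ (*-congˡ (^-double x m)))
    (solve 2 (λ x y → x :* (x :* (y :* y)) := x :* y :* (x :* y)) refl x (x ^ m))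

  cube-^ : ∀ x m → (x * x * x) ^ m ≈ x ^ m * x ^ m * x ^ m
  cube-^ x m = trans (^-distrib-* (x * x) x m) (*-congʳ (^-distrib-* x x m))

  thetaFactor-cong : ∀ {a a′ b b′} → a ≈ a′ → b ≈ b′ → ∀ i → thetaFactor a b i ≈ thetaFactor a′ b′ i
  thetaFactor-cong ea eb i = *-cong
    (*-cong (+-congˡ (*-cong ea (^-congˡ i (*-cong ea eb))))
        (+-congˡ (*-cong eb (^-congˡ i (*-cong ea eb)))))
    (+-congˡ (-‿cong (^-congˡ (suc i) (*-cong ea eb))))

  IsTheta-cong : ∀ {a a′ b b′ x} → a ≈ a′ → b ≈ b′ → IsTheta a b x → IsTheta a′ b′ x
  IsTheta-cong ea eb = HasProduct-cong (thetaFactor-cong ea eb)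

  IsTheta-swap : ∀ {a b x} → IsTheta a b x → IsTheta b a x
  IsTheta-swap {a} {b} = HasProduct-cong λ i → *-cong
    (trans (*-comm _ _) (*-cong (+-congˡ (*-congˡ (^-congˡ i (*-comm a b))))
        (+-congˡ (*-congˡ (^-congˡ i (*-comm a b))))))
    (+-congˡ (-‿cong (^-congˡ (suc i) (*-comm a b))))

  module _ (a b : Carrier) where
    private
      Q = a * b
      c = a * a * a
      d = b * b * b

    ninth-^ : ∀ {x} → x ≈ (Q * Q * Q) * (Q * Q * Q) * (Q * Q * Q) → ∀ m →
      let p = Q ^ m in x ^ m ≈ (p * p * p) * (p * p * p) * (p * p * p)
    ninth-^ e m = trans (^-congˡ m e) (trans (cube-^ (Q * Q * Q) m)
      (*-cong (*-cong (cube-^ Q m) (cube-^ Q m)) (cube-^ Q m)))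

    w-triple : ∀ m → w a b (triple m) ≈ w (c * c * d) (c * d * d) m
    w-triple zero    = refl
    w-triple (suc m) = begin
      w a b (triple m) * (a * P) * (a * (Q * P)) * (a * (Q * (Q * P)))
        ≈⟨ solve 4 (λ x P a b → x :* (a :* P) :* (a :* (a :* b :* P)) :*
            (a :* (a :* b :* (a :* b :* P)))
             := x :* (a :* a :* a :* (a :* a :* a) :* (b :* b :* b) :* (P :* P :* P)))
                 refl _ P a b ⟩
      w a b (triple m) * (c * c * d * (P * P * P))
        ≈⟨ *-cong (w-triple m) (*-congˡ (*-cong (*-cong P≈ P≈) P≈)) ⟩
      w (c * c * d) (c * d * d) m * (c * c * d * ((p * p * p) * (p * p * p) * (p * p * p)))
        ≈⟨ *-congˡ (*-congˡ (ninth-^ (solve 2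
            (λ a b → let c = a :* a :* a; d = b :* b :* b; q = a :* b in
             c :* c :* d :* (c :* d :* d) := (q :* q :* q) :* (q :* q :* q) :* (q :* q :* q))
                 refl a b) m)) ⟨
      w (c * c * d) (c * d * d) (suc m) ∎
      where
      p = Q ^ m
      P = Q ^ triple m
      P≈ : P ≈ p * p * p
      P≈ = ^-triple Q m

    -- Replacing parameters (A, B) by (A t, B / t) multiplies the term of index m by t^m; here t = c
    -- d = Q^3. `w-shift⁻` uses 1/t instead, so its power of Q stands on the other side.
    w-shift⁺ : ∀ m → w (c * c * c * d * d) d m ≈ w (c * c * d) (c * d * d) m *
        (Q ^ m * Q ^ m * Q ^ m)
    w-shift⁺ zero    = solve 0 (:1 := :1 :* (:1 :* :1 :* :1)) refl
    w-shift⁺ (suc m) = begin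
      w (c * c * c * d * d) d m * (c * c * c * d * d * (c * c * c * d * d * d) ^ m)
        ≈⟨ *-cong (w-shift⁺ m) (*-congˡ (^-congˡ m
             (solve 2 (λ c d → c :* c :* c :* d :* d :* d := c :* c :* d :* (c :* d :* d))
                 refl c d))) ⟩
      x * (p * p * p) * (c * c * c * d * d * n)
        ≈⟨ solve 5 (λ x p n a b → let c = a :* a :* a; d = b :* b :* b; q = a :* b in
             x :* (p :* p :* p) :* (c :* c :* c :* d :* d :* n)
             := x :* (c :* c :* d :* n) :* (q :* p :* (q :* p) :* (q :* p))) refl x p n a b ⟩
      w (c * c * d) (c * d * d) (suc m) * (Q ^ suc m * Q ^ suc m * Q ^ suc m) ∎
      where
      p = Q ^ m
      x = w (c * c * d) (c * d * d) m
      n = (c * c * d * (c * d * d)) ^ m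

    w-shift⁻ : ∀ m → w c (c * c * d * d * d) m * (Q ^ m * Q ^ m * Q ^ m) ≈ w (c * c * d) (c * d * d)
        m
    w-shift⁻ zero    = solve 0 (:1 :* (:1 :* :1 :* :1) := :1) refl
    w-shift⁻ (suc m) = begin
      y * (c * (c * (c * c * d * d * d)) ^ m) * (Q ^ suc m * Q ^ suc m * Q ^ suc m)
        ≈⟨ *-congʳ (*-congˡ (*-congˡ (^-congˡ m
             (solve 2 (λ c d → c :* (c :* c :* d :* d :* d) := c :* c :* d :* (c :* d :* d))
                 refl c d)))) ⟩
      y * (c * n) * (Q ^ suc m * Q ^ suc m * Q ^ suc m)
        ≈⟨ solve 5 (λ y p n a b → let c = a :* a :* a; d = b :* b :* b; q = a :* b in
             y :* (c :* n) :* (q :* p :* (q :* p) :* (q :* p))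
             := y :* (p :* p :* p) :* (c :* c :* d :* n)) refl y p n a b ⟩
      y * (p * p * p) * (c * c * d * n)
        ≈⟨ *-congʳ (w-shift⁻ m) ⟩
      w (c * c * d) (c * d * d) (suc m) ∎
      where
      p = Q ^ m
      y = w c (c * c * d * d * d) m
      n = (c * c * d * (c * d * d)) ^ m

    w-triple+1 : ∀ m → w a b (suc (triple m)) ≈ a * w (c * c * c * d * d) d m
    w-triple+1 m = begin
      w a b (triple m) * (a * Q ^ triple m)
        ≈⟨ *-cong (w-triple m) (*-congˡ (^-triple Q m)) ⟩
      w (c * c * d) (c * d * d) m * (a * (Q ^ m * Q ^ m * Q ^ m))
        ≈⟨ solve 3 (λ x a p → x :* (a :* p) := a :* (x :* p)) refl _ _ _ ⟩
      a * (w (c * c * d) (c * d * d) m * (Q ^ m * Q ^ m * Q ^ m))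
        ≈⟨ *-congˡ (w-shift⁺ m) ⟨
      a * w (c * c * c * d * d) d m ∎

    -- The index is read as 3(m + 1) - 1; the prefactor b is the theta term of index -1.
    w-triple+2 : ∀ m → w a b (suc (suc (triple m))) ≈ b * w c (c * c * d * d * d) (suc m)
    w-triple+2 m = begin
      w a b (triple m) * (a * P) * (a * (Q * P))
        ≈⟨ *-cong (*-cong (trans (w-triple m) (sym (w-shift⁻ m))) (*-congˡ P≈))
            (*-congˡ (*-congˡ P≈)) ⟩
      y * (p * p * p) * (a * (p * p * p)) * (a * (Q * (p * p * p)))
        ≈⟨ solve 4 (λ y p a b → y :* (p :* p :* p) :* (a :* (p :* p :* p)) :*
            (a :* (a :* b :* (p :* p :* p)))
             := b :* (y :* (a :* a :* a :* ((p :* p :* p) :* (p :* p :* p) :* (p :* p :* p)))))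
                 refl y p a b ⟩
      b * (y * (c * ((p * p * p) * (p * p * p) * (p * p * p))))
        ≈⟨ *-congˡ (*-congˡ (*-congˡ (ninth-^
            (solve 2 (λ a b → let c = a :* a :* a; d = b :* b :* b; q = a :* b in
             c :* (c :* c :* d :* d :* d) := (q :* q :* q) :* (q :* q :* q) :* (q :* q :* q))
                 refl a b) m))) ⟨
      b * w c (c * c * d * d * d) (suc m) ∎
      where
      p = Q ^ m
      P = Q ^ triple m
      y = w c (c * c * d * d * d) m
      P≈ : P ≈ p * p * p
      P≈ = ^-triple Q m

  module _ (a b : Carrier) where
    private
      c = a * a * a
      d = b * b * b

    -- The cut-off 3K + 1 leaves no remainder: the indices of absolute value at most 3K + 1 are
    -- exactly 3m, 3m + 1 and 3m - 1 with m between -K and K, which gives three symmetric partial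
    -- sums.
    thetaSum-triple : ∀ K → thetaSum a b (suc (triple K)) ≈
      thetaSum (c * c * d) (c * d * d) K
        + a * thetaSum (c * c * c * d * d) d K + b * thetaSum c (c * c * d * d * d) K
    thetaSum-triple zero = solve 2 (λ a b →
      :0 :+ :1 :+ (:1 :* (a :* :1) :+ :1 :* (b :* :1))
          := (:0 :+ :1) :+ a :* (:0 :+ :1) :+ b :* (:0 :+ :1)) refl a b
    thetaSum-triple (suc K) = begin
      S + (w a b k+2 + w b a k+2) + (w a b k+3 + w b a k+3) + (w a b k+4 + w b a k+4)
        ≈⟨ +-cong (+-cong (+-cong (thetaSum-triple K)
             (+-cong (w-triple+2 a b K) (trans (w-triple+2 b a K)
               (*-congˡ (w-cong refl (solve 2 (λ c d → d :* d :* c :* c :* c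
                   := c :* c :* c :* d :* d) refl c d) (suc K))))))
             (+-cong (w-triple a b (suc K)) (trans (w-triple b a (suc K))
               (w-cong (solve 2 (λ c d → d :* d :* c := c :* d :* d) refl c d)
                   (solve 2 (λ c d → d :* c :* c := c :* c :* d) refl c d) (suc K)))))
             (+-cong (w-triple+1 a b (suc K)) (trans (w-triple+1 b a (suc K))
               (*-congˡ (w-cong (solve 2 (λ c d → d :* d :* d :* c :* c := c :* c :* d :* d :* d)
                   refl c d) refl (suc K))))) ⟩
      (s₁ + a * s₂ + b * s₃) + (b * x₁ + a * x₂) + (x₃ + x₄) + (a * x₅ + b * x₆)
        ≈⟨ solve 11 (λ a b s₁ s₂ s₃ x₁ x₂ x₃ x₄ x₅ x₆ →
             (s₁ :+ a :* s₂ :+ b :* s₃) :+ (b :* x₁ :+ a :* x₂) :+ (x₃ :+ x₄) :+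
                 (a :* x₅ :+ b :* x₆)
             := (s₁ :+ (x₃ :+ x₄)) :+ a :* (s₂ :+ (x₅ :+ x₂)) :+ b :* (s₃ :+ (x₁ :+ x₆))) refl
             a b s₁ s₂ s₃ x₁ x₂ x₃ x₄ x₅ x₆ ⟩
      (s₁ + (x₃ + x₄)) + a * (s₂ + (x₅ + x₂)) + b * (s₃ + (x₁ + x₆)) ∎
      where
      k+2 = suc (suc (triple K))
      k+3 = suc k+2
      k+4 = suc k+3
      S  = thetaSum a b (suc (triple K))
      s₁ = thetaSum (c * c * d) (c * d * d) K
      s₂ = thetaSum (c * c * c * d * d) d K
      s₃ = thetaSum c (c * c * d * d * d) K
      x₁ = w c (c * c * d * d * d) (suc K)
      x₂ = w d (c * c * c * d * d) (suc K)
      x₃ = w (c * c * d) (c * d * d) (suc K)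
      x₄ = w (c * d * d) (c * c * d) (suc K)
      x₅ = w (c * c * c * d * d) d (suc K)
      x₆ = w (c * c * d * d * d) c (suc K)

    theta-3-dissection : ∀ {x x₁ x₂ x₃} → V 1 (a * b) → IsTheta a b x →
      IsTheta (c * c * d) (c * d * d) x₁ → IsTheta (c * c * c * d * d) d x₂ → IsTheta c
          (c * c * d * d * d) x₃ →
      x ≈ x₁ + a * x₂ + b * x₃
    theta-3-dissection v t t₁ t₂ t₃ = limit-unique
      (⟶-subseq (λ K → suc (triple K)) (λ K → ℕ.m≤n⇒m≤1+n (n≤triple K)) (tripleProduct a b v t))
      (⟶-resp (λ K → sym (thetaSum-triple K))
        -- Each of the three new pairs of parameters has product (a b)^9, so its order is positive
        -- because that of a b is.
        (⟶-+ (⟶-+ (tripleProduct _ _ (V-resp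
            (solve 2 (λ a b → let c = a :* a :* a; d = b :* b :* b in
                  (a :* a :* b :* b :* a :* a :* b :* b :* a :* a :* b :* b :* a :* a :* b :* b) :*
                      (a :* b)
                  := c :* c :* d :* (c :* d :* d)) refl a b) (V-*ˡ _ v)) t₁)
          (⟶-* (⟶-const a) (tripleProduct _ _
              (V-resp (solve 2 (λ a b → let c = a :* a :* a; d = b :* b :* b in
                  (a :* a :* b :* b :* a :* a :* b :* b :* a :* a :* b :* b :* a :* a :* b :* b) :*
                      (a :* b)
                  := c :* c :* c :* d :* d :* d) refl a b) (V-*ˡ _ v)) t₂)))
          (⟶-* (⟶-const b) (tripleProduct _ _
              (V-resp (solve 2 (λ a b → let c = a :* a :* a; d = b :* b :* b in
                  (a :* a :* b :* b :* a :* a :* b :* b :* a :* a :* b :* b :* a :* a :* b :* b) :*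
                      (a :* b)
                  := c :* (c :* c :* d :* d :* d)) refl a b) (V-*ˡ _ v)) t₃))))
      where open TripleProduct using (tripleProduct)

  module _ (a c : Carrier) where
    private
      b = a * c
      Q = a * b
      a⁴ = a * a * a * a
      e = a⁴ * a⁴ * c * c * c
      A = a⁴ * c
      B = a⁴ * c * c * c

    fourth-^ : ∀ {x} → x ≈ Q * Q * (Q * Q) → ∀ m → let p = Q ^ m in x ^ m ≈ p * p * (p * p)
    fourth-^ e m = trans (^-congˡ m e)
        (trans (^-distrib-* (Q * Q) (Q * Q) m) (*-cong (^-distrib-* Q Q m) (^-distrib-* Q Q m)))

    AB^ : ∀ m → let p = Q ^ m in (A * B) ^ m ≈ p * p * (p * p)
    AB^ = fourth-^ (solve 2 (λ a c → let q = a :* (a :* c); a⁴ = a :* a :* a :* a in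
      a⁴ :* c :* (a⁴ :* c :* c :* c) := q :* q :* (q :* q)) refl a c)

    BA^ : ∀ m → let p = Q ^ m in (B * A) ^ m ≈ p * p * (p * p)
    BA^ m = trans (^-congˡ m (*-comm B A)) (AB^ m)

    ec^ : ∀ m → let p = Q ^ m in (e * c) ^ m ≈ p * p * (p * p)
    ec^ = fourth-^ (solve 2 (λ a c → let q = a :* (a :* c); a⁴ = a :* a :* a :* a in
      a⁴ :* a⁴ :* c :* c :* c :* c := q :* q :* (q :* q)) refl a c)

    ce^ : ∀ m → let p = Q ^ m in (c * e) ^ m ≈ p * p * (p * p)
    ce^ m = trans (^-congˡ m (*-comm c e)) (ec^ m)

    w-double⁺ : ∀ m → w a b (double m) ≈ w A B m
    w-double⁺ zero    = refl
    w-double⁺ (suc m) = begin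
      w a b (double m) * (a * Q ^ double m) * (a * (Q * Q ^ double m))
        ≈⟨ *-cong (*-cong (w-double⁺ m) (*-congˡ (^-double Q m)))
            (*-congˡ (*-congˡ (^-double Q m))) ⟩
      w A B m * (a * (p * p)) * (a * (Q * (p * p)))
        ≈⟨ solve 4 (λ x p a c → x :* (a :* (p :* p)) :* (a :* (a :* (a :* c) :* (p :* p)))
             := x :* (a :* a :* a :* a :* c :* (p :* p :* (p :* p)))) refl _ p a c ⟩
      w A B m * (A * (p * p * (p * p)))
        ≈⟨ *-congˡ (*-congˡ (AB^ m)) ⟨
      w A B (suc m) ∎
      where p = Q ^ m

    ba^ : ∀ m → (b * a) ^ double m ≈ Q ^ m * Q ^ m
    ba^ m = trans (^-congˡ (double m) (*-comm b a)) (^-double Q m)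

    w-double⁻ : ∀ m → w b a (double m) ≈ w B A m
    w-double⁻ zero    = refl
    w-double⁻ (suc m) = begin
      w b a (double m) * (b * (b * a) ^ double m) * (b * (b * a * (b * a) ^ double m))
        ≈⟨ *-cong (*-cong (w-double⁻ m) (*-congˡ (ba^ m))) (*-congˡ (*-congˡ (ba^ m))) ⟩
      w B A m * (b * (p * p)) * (b * (b * a * (p * p)))
        ≈⟨ solve 4 (λ x p a c → let b = a :* c in x :* (b :* (p :* p)) :*
            (b :* (b :* a :* (p :* p)))
             := x :* (a :* a :* a :* a :* c :* c :* c :* (p :* p :* (p :* p)))) refl _ p a c ⟩
      w B A m * (B * (p * p * (p * p)))
        ≈⟨ *-congˡ (*-congˡ (BA^ m)) ⟨
      w B A (suc m) ∎
      where p = Q ^ m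

    w-odd⁺ : ∀ m → w e c m ≈ w A B m * (Q ^ m * Q ^ m)
    w-odd⁺ zero    = solve 0 (:1 := :1 :* (:1 :* :1)) refl
    w-odd⁺ (suc m) = begin
      w e c m * (e * (e * c) ^ m)
        ≈⟨ *-cong (w-odd⁺ m) (*-congˡ (trans (ec^ m) (sym (AB^ m)))) ⟩
      w A B m * (p * p) * (e * n)
        ≈⟨ solve 5 (λ x p n a c → let q = a :* (a :* c); a⁴ = a :* a :* a :* a in
             x :* (p :* p) :* (a⁴ :* a⁴ :* c :* c :* c :* n)
                 := x :* (a⁴ :* c :* n) :* (q :* p :* (q :* p))) refl _ p n a c ⟩
      w A B (suc m) * (Q ^ suc m * Q ^ suc m) ∎
      where
      p = Q ^ m
      n = (A * B) ^ m

    w-odd⁻ : ∀ m → w c e m * (Q ^ m * Q ^ m) ≈ w B A m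
    w-odd⁻ zero    = solve 0 (:1 :* (:1 :* :1) := :1) refl
    w-odd⁻ (suc m) = begin
      w c e m * (c * (c * e) ^ m) * (Q ^ suc m * Q ^ suc m)
        ≈⟨ *-congʳ (*-congˡ (*-congˡ (trans (ce^ m) (sym (BA^ m))))) ⟩
      w c e m * (c * n) * (Q ^ suc m * Q ^ suc m)
        ≈⟨ solve 5 (λ x p n a c → let q = a :* (a :* c); a⁴ = a :* a :* a :* a in
             x :* (c :* n) :* (q :* p :* (q :* p)) := x :* (p :* p) :* (a⁴ :* c :* c :* c :* n))
                 refl _ p n a c ⟩
      w c e m * (p * p) * (B * n)
        ≈⟨ *-congʳ (w-odd⁻ m) ⟩
      w B A (suc m) ∎
      where
      p = Q ^ m
      n = (B * A) ^ m

    w-double+1⁺ : ∀ m → w a b (suc (double m)) ≈ a * w e c m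
    w-double+1⁺ m = trans (*-cong (w-double⁺ m) (*-congˡ (^-double Q m)))
      (trans (solve 3 (λ x a p → x :* (a :* p) := a :* (x :* p)) refl _ _ _)
          (*-congˡ (sym (w-odd⁺ m))))

    w-double+1⁻ : ∀ m → w b a (suc (double m)) ≈ a * w c e (suc m)
    w-double+1⁻ m = begin
      w b a (double m) * (b * (b * a) ^ double m)
        ≈⟨ *-cong (trans (w-double⁻ m) (sym (w-odd⁻ m))) (*-congˡ (ba^ m)) ⟩
      w c e m * (p * p) * (b * (p * p))
        ≈⟨ solve 4 (λ x p a c → x :* (p :* p) :* (a :* c :* (p :* p))
            := a :* (x :* (c :* (p :* p :* (p :* p))))) refl _ p a c ⟩
      a * (w c e m * (c * (p * p * (p * p))))
        ≈⟨ *-congˡ (*-congˡ (*-congˡ (ce^ m))) ⟨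
      a * w c e (suc m) ∎
      where p = Q ^ m

    -- The term of index K of the second series would come from the index 2K+1.
    thetaSum-double : ∀ K → thetaSum a b (double K) + a * w e c K ≈ thetaSum A B K + a * thetaSum e
        c K
    thetaSum-double zero    = solve 1 (λ a → :0 :+ :1 :+ a :* :1 := :0 :+ :1 :+ a :* (:0 :+ :1))
        refl a
    thetaSum-double (suc K) = begin
      S + (w a b k+1 + w b a k+1) + (w a b k+2 + w b a k+2) + a * w e c (suc K)
        ≈⟨ +-congʳ (+-cong (+-congˡ (+-cong (w-double+1⁺ K) (w-double+1⁻ K)))
            (+-cong (w-double⁺ (suc K)) (w-double⁻ (suc K)))) ⟩
      S + (a * w e c K + a * w c e (suc K)) + (w A B (suc K) + w B A (suc K)) + a * w e c (suc K)
        ≈⟨ solve 7 (λ a s x y z t u → s :+ (a :* x :+ a :* y) :+ (z :+ t) :+ a :* u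
             := (s :+ a :* x) :+ (z :+ t) :+ a :* (u :+ y))
                 refl a S (w e c K) (w c e (suc K)) (w A B (suc K)) (w B A (suc K))
                 (w e c (suc K)) ⟩
      S + a * w e c K + thetaTerm A B (suc K) + a * thetaTerm e c (suc K)
        ≈⟨ +-congʳ (+-congʳ (thetaSum-double K)) ⟩
      thetaSum A B K + a * thetaSum e c K + thetaTerm A B (suc K) + a * thetaTerm e c (suc K)
        ≈⟨ solve 5 (λ a s t x y → s :+ a :* t :+ x :+ a :* y := (s :+ x) :+ a :* (t :+ y))
            refl _ _ _ _ _ ⟩
      thetaSum A B (suc K) + a * thetaSum e c (suc K) ∎
      where
      k+1 = suc (double K)
      k+2 = suc k+1
      S = thetaSum a b (double K)

    -- The splitting f(a,b) = f(a³b, ab³) + a f(a⁵b³, b/a) by the parity of the index. Writing b = a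
    -- c makes the quotient b/a an element of the ring.
    theta-2-dissection : ∀ {x x₁ x₂} → V 1 (a * b) → IsTheta a b x → IsTheta A B x₁ → IsTheta e c x₂
        →
      x ≈ x₁ + a * x₂
    theta-2-dissection v t t₁ t₂ = limit-unique
      (⟶-subseq double n≤double (tripleProduct a b v t))
      -- The odd indices are cut off asymmetrically, which leaves the single term `a * w e c K`; its
      -- order is at least L once K exceeds L.
      (⟶-close (λ L → suc L , λ K L<K → ≈[]-trans
          (V-resp (solve 3 (λ s a y → :- (a :* y) := s :- (s :+ a :* y)) refl _ _ _)
              (V-neg (V-*ˡ a (V-w K L<K))))
          (≈⇒≈[] (thetaSum-double K)))
        (⟶-+ (tripleProduct _ _ (V-resp (solve 2 (λ a c → let a⁴ = a :* a :* a :* a in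
                  (a :* a :* c :* a :* a :* c :* a :* a :* c) :* (a :* (a :* c))
                      := a⁴ :* c :* (a⁴ :* c :* c :* c)) refl a c) (V-*ˡ _ v)) t₁)
             (⟶-* (⟶-const a) (tripleProduct _ _ ec∈V t₂))))
      where
      open TripleProduct using (tripleProduct)
      ec∈V : V 1 (e * c)
      ec∈V = V-resp (solve 2 (λ a c → let a⁴ = a :* a :* a :* a in
               (a :* a :* c :* a :* a :* c :* a :* a :* c) :* (a :* (a :* c))
                   := a⁴ :* a⁴ :* c :* c :* c :* c) refl a c) (V-*ˡ _ v)
      V-w : ∀ {L} K → L ℕ.< K → V L (w e c K)
      V-w (suc K) (s≤s L≤K) = V-anti L≤K (V-*ˡ _ (V-*ˡ e (V-^ ec∈V K)))

-- Dual numbers and logarithmic derivatives of products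

module DualNumbers {R : CommutativeRing 0ℓ 0ℓ} (F : Filtration R) where
  open CommutativeRing R hiding (zero)
  open Filtration F
  open RingSolving R
  private module L = Limits F

  infixl 7 _·_
  _·_ : Carrier × Carrier → Carrier × Carrier → Carrier × Carrier
  (a , b) · (c , d) = a * c , a * d + b * c

  -- The pair (x , y) is x + y ε, with ε² = 0.
  dualRing : CommutativeRing 0ℓ 0ℓ
  dualRing = record
    { Carrier = Carrier × Carrier
    ; _≈_ = λ x y → (proj₁ x ≈ proj₁ y) × (proj₂ x ≈ proj₂ y)
    ; _+_ = λ x y → proj₁ x + proj₁ y , proj₂ x + proj₂ y
    ; _*_ = _·_
    ; -_  = λ x → - proj₁ x , - proj₂ x
    ; 0#  = 0# , 0#
    ; 1#  = 1# , 0#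
    ; isCommutativeRing = record
      { isRing = record
        { +-isAbelianGroup = record
          { isGroup = record
            { isMonoid = record
              { isSemigroup = record
                { isMagma = record
                  { isEquivalence = record
                    { refl  = refl , refl
                    ; sym   = λ e → sym (proj₁ e) , sym (proj₂ e)
                    ; trans = λ e e′ → trans (proj₁ e) (proj₁ e′) , trans (proj₂ e) (proj₂ e′)
                    }
                  ; ∙-cong = λ e e′ → +-cong (proj₁ e) (proj₁ e′) , +-cong (proj₂ e) (proj₂ e′)
                  }
                ; assoc = λ x y z → +-assoc _ _ _ , +-assoc _ _ _
                }
              ; identity = (λ x → +-identityˡ _ , +-identityˡ _) ,
                  (λ x → +-identityʳ _ , +-identityʳ _)
              }
            ; inverse = (λ x → -‿inverseˡ _ , -‿inverseˡ _) , (λ x → -‿inverseʳ _ , -‿inverseʳ _)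
            ; ⁻¹-cong = λ e → -‿cong (proj₁ e) , -‿cong (proj₂ e)
            }
          ; comm = λ x y → +-comm _ _ , +-comm _ _
          }
        ; *-cong = λ e e′ → *-cong (proj₁ e) (proj₁ e′)
                          , +-cong (*-cong (proj₁ e) (proj₂ e′)) (*-cong (proj₂ e) (proj₁ e′))
        ; *-assoc = λ (a , b) (c , d) (x , y) → *-assoc a c x
            , solve 6 (λ a b c d x y → a :* c :* y :+ (a :* d :+ b :* c) :* x
                := a :* (c :* y :+ d :* x) :+ b :* (c :* x)) refl a b c d x y
        ; *-identity = (λ (a , b) → *-identityˡ a , solve 2 (λ a b → :1 :* b :+ :0 :* a := b)
            refl a b)
                     , (λ (a , b) → *-identityʳ a , solve 2 (λ a b → a :* :0 :+ b :* :1 := b)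
                         refl a b)
        ; distrib = (λ (x , y) (a , b) (c , d) → distribˡ x a c
                      , solve 6 (λ a b c d x y → x :* (b :+ d) :+ y :* (a :+ c)
                          := x :* b :+ y :* a :+ (x :* d :+ y :* c)) refl a b c d x y)
                  , (λ (x , y) (a , b) (c , d) → distribʳ x a c
                      , solve 6 (λ a b c d x y → (a :+ c) :* y :+ (b :+ d) :* x
                          := a :* y :+ b :* x :+ (c :* y :+ d :* x)) refl a b c d x y)
        }
      ; *-comm = λ (a , b) (c , d) → *-comm a c , solve 4 (λ a b c d → a :* d :+ b :* c
          := c :* b :+ d :* a) refl a b c d
      }
    }

  dualFiltration : Filtration dualRing
  dualFiltration = record
    { V         = λ n x → V n (proj₁ x) × V n (proj₂ x)
    ; V-resp    = λ e v → V-resp (proj₁ e) (proj₁ v) , V-resp (proj₂ e) (proj₂ v)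
    ; V-all     = λ x → V-all _ , V-all _
    ; V-0#      = λ n → V-0# n , V-0# n
    ; V-+       = λ v v′ → V-+ (proj₁ v) (proj₁ v′) , V-+ (proj₂ v) (proj₂ v′)
    ; V-*       = λ v v′ → V-* (proj₁ v) (proj₁ v′) , V-+ (V-* (proj₁ v) (proj₂ v′))
        (V-* (proj₂ v) (proj₁ v′))
    ; V-anti    = λ m≤n v → V-anti m≤n (proj₁ v) , V-anti m≤n (proj₂ v)
    ; separated = λ v → separated (λ n → proj₁ (v n)) , separated (λ n → proj₂ (v n))
    }

  private module D = Limits dualFiltration

  ⟶-pair : ∀ {s t x y} → s L.⟶ x → t L.⟶ y → (λ n → s n , t n) D.⟶ (x , y)
  ⟶-pair l m K with l K | m K
  ... | N , p | M , r = N ℕ.⊔ M , λ n b →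
    p n (ℕ.≤-trans (ℕ.m≤m⊔n N M) b) , r n (ℕ.≤-trans (ℕ.m≤n⊔m N M) b)

  Π<-log : ∀ u v n → let π = D.Π< (λ i → u i , u i * v i) n in
    (proj₁ π ≈ L.Π< u n) × (proj₂ π ≈ L.Π< u n * L.Σ< v n)
  Π<-log u v zero    = refl , sym (zeroʳ 1#)
  Π<-log u v (suc n) with Π<-log u v n
  ... | e , e′ = *-congʳ e , trans (+-cong (*-congʳ e) (*-congʳ e′))
    (solve 4 (λ p a b s → p :* (a :* b) :+ p :* s :* a := p :* a :* (s :+ b)) refl _ _ _ _)

  -- (x , x * y) is x (1 + y ε), and such factors multiply by adding the y.
  HasProduct-log : ∀ {u v x y} → L.HasProduct u x → L.Σ< v L.⟶ y →
                   D.HasProduct (λ i → u i , u i * v i) (x , x * y)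
  HasProduct-log {u} {v} p s = D.⟶-resp
    (λ n → sym (proj₁ (Π<-log u v n)) , sym (proj₂ (Π<-log u v n)))
    (⟶-pair p (L.⟶-* p s))

-- Infinite q-products and their inverses

module Products {R : CommutativeRing 0ℓ 0ℓ} {F : Filtration R} (C : Complete F)
  (q : CommutativeRing.Carrier R) (Vq : Filtration.V F 1 q) where
  open CommutativeRing R hiding (zero)
  open Filtration F
  open Limits F
  open Complete C
  open Theta F
  open Dissections F using (^-double; ^-triple)
  open RingSolving R
  open import Algebra.Properties.Semiring.Exp semiring using (_^_; ^-homo-*; ^-congˡ)
  open import Algebra.Properties.CommutativeSemiring.Exp commutativeSemiring using (^-distrib-*)
  open import Relation.Binary.Reasoning.Setoid setoid

  product-complete : ∀ {u} → (∀ i → u i ≈[ suc i ] 1#) → HasProduct u (lim (Π< u))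
  product-complete {u} v = complete λ n → V-resp
    (solve 2 (λ p x → p :* (x :- :1) := p :* x :- p) refl (Π< u n) (u n)) (V-*ˡ (Π< u n) (v n))

  sum-complete : ∀ {u} → (∀ i → V (suc i) (u i)) → Σ< u ⟶ lim (Σ< u)
  sum-complete {u} v = complete λ n → V-resp
    (solve 2 (λ p x → x := p :+ x :- p) refl (Σ< u n) (u n)) (v n)

  -- The inverse of 1 - x is taken as a series so that positivity of x is visibly inherited.
  -- Stopping the n-th sum at x^n makes neighbours differ by x^(n+1), the rate `complete` asks for.
  geo : Carrier → Carrier
  geo x = lim (λ n → Σ< (x ^_) (suc n))

  geo-sum : ∀ {x} → V 1 x → (λ n → Σ< (x ^_) (suc n)) ⟶ geo x
  geo-sum {x} v = complete λ n → V-resp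
    (solve 2 (λ p x → x := p :+ x :- p) refl (Σ< (x ^_) (suc n)) (x ^ suc n)) (V-^ v (suc n))

  Σ<-geometric : ∀ x n → (1# - x) * Σ< (x ^_) n ≈ 1# - x ^ n
  Σ<-geometric x zero    = solve 1 (λ x → (:1 :- x) :* :0 := :1 :- :1) refl x
  Σ<-geometric x (suc n) = begin
    (1# - x) * (Σ< (x ^_) n + x ^ n)              ≈⟨ distribˡ _ _ _ ⟩
    (1# - x) * Σ< (x ^_) n + (1# - x) * x ^ n     ≈⟨ +-congʳ (Σ<-geometric x n) ⟩
    (1# - x ^ n) + (1# - x) * x ^ n              
        ≈⟨ solve 2 (λ x y → :1 :- y :+ (:1 :- x) :* y := :1 :- x :* y) refl x (x ^ n) ⟩
    1# - x ^ suc n                                ∎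

  geo-inverse : ∀ {x} → V 1 x → (1# - x) * geo x ≈ 1#
  geo-inverse {x} v = limit-unique
    (⟶-* (⟶-const (1# - x)) (geo-sum v))
    (⟶-close (λ L → L , λ n L≤n → V-resp
        (trans (solve 1 (λ y → :- y := (:1 :- y) :- :1) refl (x ^ suc n))
            (+-congʳ (sym (Σ<-geometric x (suc n)))))
        (V-neg (V-anti (ℕ.m≤n⇒m≤1+n L≤n) (V-^ v (suc n)))))
      (⟶-const 1#))

  inverse-unique : ∀ {x y z} → x * y ≈ 1# → x * z ≈ 1# → y ≈ z
  inverse-unique {x} {y} {z} e e′ = begin
    y            ≈⟨ *-identityʳ y ⟨
    y * 1#       ≈⟨ *-congˡ e′ ⟨
    y * (x * z)  ≈⟨ solve 3 (λ x y z → y :* (x :* z) := x :* y :* z) refl x y z ⟩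
    x * y * z    ≈⟨ *-congʳ e ⟩
    1# * z       ≈⟨ *-identityˡ z ⟩
    z            ∎

  Vq^ : ∀ n .{{_ : NonZero n}} → V 1 (q ^ n)
  Vq^ (suc n) = V-anti (s≤s z≤n) (V-^ Vq (suc n))

  power : ℕ → ℕ → ℕ → Carrier
  power c d i = q ^ c * (q ^ d) ^ i

  power-order : ∀ c d .{{_ : NonZero c}} .{{_ : NonZero d}} i → V (suc i) (power c d i)
  power-order c d i = V-* (Vq^ c) (V-^ (Vq^ d) i)

  V-power : ∀ c d .{{_ : NonZero c}} i → V 1 (power c d i)
  V-power c d i = V-resp (*-comm _ _) (V-*ˡ _ (Vq^ c))

  V-1- : ∀ {n x} → V n x → 1# - x ≈[ n ] 1#
  V-1- {x = x} v = V-resp (solve 1 (λ x → :- x := :1 :- x :- :1) refl x) (V-neg v)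

  V-1+ : ∀ {n x} → V n x → 1# + x ≈[ n ] 1#
  V-1+ {x = x} v = V-resp (solve 1 (λ x → x := :1 :+ x :- :1) refl x) v

  V-geo : ∀ {n x} → V 1 x → V n x → geo x ≈[ n ] 1#
  V-geo {x = x} v₁ v = V-resp
    (begin
      x * geo x                                
          ≈⟨ solve 2 (λ x g → x :* g := g :- (:1 :- x) :* g) refl x (geo x) ⟩
      geo x - (1# - x) * geo x                  ≈⟨ +-congˡ (-‿cong (geo-inverse v₁)) ⟩
      geo x - 1#                                ∎)
    (V-resp (*-comm _ _) (V-*ˡ (geo x) v))

  -- (q^c ; q^d)∞ , its inverse, and (-q^c ; q^d)∞
  poch ipoch npoch : ℕ → ℕ → Carrier
  poch  c d = lim (Π< (λ i → 1# - power c d i))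
  ipoch c d = lim (Π< (λ i → geo (power c d i)))
  npoch c d = lim (Π< (λ i → 1# + power c d i))

  module _ (c d : ℕ) .{{_ : NonZero c}} .{{_ : NonZero d}} where

    poch-product : HasProduct (λ i → 1# - power c d i) (poch c d)
    poch-product = product-complete λ i → V-1- (power-order c d i)

    ipoch-product : HasProduct (λ i → geo (power c d i)) (ipoch c d)
    ipoch-product = product-complete λ i → V-geo (V-power c d i) (power-order c d i)

    npoch-product : HasProduct (λ i → 1# + power c d i) (npoch c d)
    npoch-product = product-complete λ i → V-1+ (power-order c d i)

    poch-near-1 : poch c d ≈[ 1 ] 1#
    poch-near-1 = HasProduct-near (λ i → V-1- (V-power c d i)) poch-product

    poch-ipoch : poch c d * ipoch c d ≈ 1#
    poch-ipoch = limit-unique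
      (HasProduct-cong (λ i → geo-inverse (V-power c d i))
          (HasProduct-* poch-product ipoch-product))
      (⟶-resp (λ n → sym (Π<-1 n)) (⟶-const 1#))

  instance
    +-nonZero : ∀ {m n} .{{_ : NonZero m}} → NonZero (m ℕ.+ n)
    +-nonZero {suc m} = _

  power-+ : ∀ c c′ d d′ i → power (c ℕ.+ c′) (d ℕ.+ d′) i ≈ power c d i * power c′ d′ i
  power-+ c c′ d d′ i = begin
    q ^ (c ℕ.+ c′) * (q ^ (d ℕ.+ d′)) ^ i
      ≈⟨ *-cong (^-homo-* q c c′) (trans (^-congˡ i (^-homo-* q d d′)) (^-distrib-* _ _ i)) ⟩
    q ^ c * q ^ c′ * ((q ^ d) ^ i * (q ^ d′) ^ i)
      ≈⟨ solve 4 (λ a b c d → a :* b :* (c :* d) := a :* c :* (b :* d)) refl _ _ _ _ ⟩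
    power c d i * power c′ d′ i ∎

  power-suc : ∀ c d i → power c d (suc i) ≈ power (c ℕ.+ d) d i
  power-suc c d i = trans (sym (*-assoc _ _ _)) (*-congʳ (sym (^-homo-* q c d)))

  power-double : ∀ c d i → power c d (double i) ≈ power c (d ℕ.+ d) i
  power-double c d i = *-congˡ (trans (^-double (q ^ d) i)
    (sym (trans (^-congˡ i (^-homo-* q d d)) (^-distrib-* _ _ i))))

  power-triple : ∀ c d i → power c d (triple i) ≈ power c (d ℕ.+ d ℕ.+ d) i
  power-triple c d i = *-congˡ (trans (^-triple (q ^ d) i)
    (sym (trans (^-congˡ i (trans (^-homo-* q (d ℕ.+ d) d) (*-congʳ (^-homo-* q d d))))
      (trans (^-distrib-* _ _ i) (*-congʳ (^-distrib-* _ _ i))))))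

  module _ (c d : ℕ) .{{_ : NonZero c}} .{{_ : NonZero d}} where

    npoch-poch : npoch c d * poch c d ≈ poch (c ℕ.+ c) (d ℕ.+ d)
    npoch-poch = limit-unique
      (HasProduct-* (npoch-product c d) (poch-product c d))
      (HasProduct-cong
        (λ i → trans (+-congˡ (-‿cong (power-+ c c d d i)))
          (solve 1 (λ x → :1 :- x :* x := (:1 :+ x) :* (:1 :- x)) refl (power c d i)))
        (poch-product (c ℕ.+ c) (d ℕ.+ d)))

    poch-head : poch c d ≈ (1# - q ^ c) * poch (c ℕ.+ d) d
    poch-head = trans
      (limit-unique (poch-product c d)
        (HasProduct-head (HasProduct-cong (λ i → +-congˡ (-‿cong (sym (power-suc c d i))))
            (poch-product (c ℕ.+ d) d))))
      (*-congʳ (+-congˡ (-‿cong (*-identityʳ _))))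

    poch-double : poch c d ≈ poch c (d ℕ.+ d) * poch (c ℕ.+ d) (d ℕ.+ d)
    poch-double = limit-unique
      (HasProduct-double (poch-product c d))
      (HasProduct-cong
        (λ i → *-cong (+-congˡ (-‿cong (sym (power-double c d i))))
                      (+-congˡ (-‿cong (sym (trans (power-suc c d (double i))
                          (power-double (c ℕ.+ d) d i))))))
        (HasProduct-* (poch-product c (d ℕ.+ d)) (poch-product (c ℕ.+ d) (d ℕ.+ d))))

    poch-triple : poch c d ≈ poch c (d ℕ.+ d ℕ.+ d) * poch (c ℕ.+ d) (d ℕ.+ d ℕ.+ d)
                             * poch (c ℕ.+ d ℕ.+ d) (d ℕ.+ d ℕ.+ d)
    poch-triple = limit-unique
      (HasProduct-triple (poch-product c d))
      (HasProduct-cong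
        (λ i → *-cong (*-cong (+-congˡ (-‿cong (sym (power-triple c d i))))
                              (+-congˡ (-‿cong (sym (trans (power-suc c d (triple i))
                                  (power-triple (c ℕ.+ d) d i))))))
                      (+-congˡ (-‿cong (sym (trans (power-suc c d (suc (triple i)))
                         (trans (power-suc (c ℕ.+ d) d (triple i))
                             (power-triple (c ℕ.+ d ℕ.+ d) d i)))))))
        (HasProduct-* (HasProduct-* (poch-product c d³) (poch-product (c ℕ.+ d) d³))
            (poch-product (c ℕ.+ d ℕ.+ d) d³)))
      where d³ = d ℕ.+ d ℕ.+ d

  -- The source of strictness: at c = 3 it says that multiplying by 1 - q^3 still leaves an inverse
  -- product, so no negative coefficient can appear.
  ipoch-head : ∀ c d .{{_ : NonZero c}} .{{_ : NonZero d}} → (1# - q ^ c) * ipoch c d ≈ ipoch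
      (c ℕ.+ d) d
  ipoch-head c d = inverse-unique
    (begin
      poch (c ℕ.+ d) d * ((1# - q ^ c) * ipoch c d)
        ≈⟨ solve 3 (λ x y z → x :* (y :* z) := y :* x :* z) refl _ _ _ ⟩
      (1# - q ^ c) * poch (c ℕ.+ d) d * ipoch c d  ≈⟨ *-congʳ (poch-head c d) ⟨
      poch c d * ipoch c d                         ≈⟨ poch-ipoch c d ⟩
      1#                                           ∎)
    (poch-ipoch (c ℕ.+ d) d)

  module _ (c d : ℕ) .{{_ : NonZero c}} .{{_ : NonZero d}} where

    private
      base-suc : ∀ i → (q ^ c * q ^ d) ^ suc i ≈ power (c ℕ.+ d) (c ℕ.+ d) i
      base-suc i = sym (^-congˡ (suc i) (^-homo-* q c d))

    IsTheta-poch : IsTheta (- (q ^ c)) (- (q ^ d))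
        (poch c (c ℕ.+ d) * poch d (c ℕ.+ d) * poch (c ℕ.+ d) (c ℕ.+ d))
    IsTheta-poch = HasProduct-cong
      (λ i → *-cong (*-cong (factor c i) (factor d i))
          (+-congˡ (-‿cong (sym (trans (^-congˡ (suc i) base) (base-suc i))))))
      (HasProduct-* (HasProduct-* (poch-product c (c ℕ.+ d)) (poch-product d (c ℕ.+ d)))
          (poch-product (c ℕ.+ d) (c ℕ.+ d)))
      where
      base : - (q ^ c) * - (q ^ d) ≈ q ^ c * q ^ d
      base = solve 2 (λ x y → :- x :* :- y := x :* y) refl _ _
      factor : ∀ e i → 1# - power e (c ℕ.+ d) i ≈ 1# + - (q ^ e) * (- (q ^ c) * - (q ^ d)) ^ i
      factor e i = +-congˡ (trans (-‿cong
          (*-congˡ (trans (^-congˡ i (^-homo-* q c d)) (^-congˡ i (sym base)))))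
        (solve 2 (λ x y → :- (x :* y) := :- x :* y) refl (q ^ e) _))

    IsTheta-npoch : IsTheta (q ^ c) (q ^ d)
        (npoch c (c ℕ.+ d) * npoch d (c ℕ.+ d) * poch (c ℕ.+ d) (c ℕ.+ d))
    IsTheta-npoch = HasProduct-cong
      (λ i → *-cong (*-cong (factor c i) (factor d i)) (+-congˡ (-‿cong (sym (base-suc i)))))
      (HasProduct-* (HasProduct-* (npoch-product c (c ℕ.+ d)) (npoch-product d (c ℕ.+ d)))
          (poch-product (c ℕ.+ d) (c ℕ.+ d)))
      where
      factor : ∀ e i → 1# + power e (c ℕ.+ d) i ≈ 1# + q ^ e * (q ^ c * q ^ d) ^ i
      factor e i = +-congˡ (*-congˡ (^-congˡ i (^-homo-* q c d)))

  IsTheta-exists : ∀ {a b} → V 1 a → V 1 b → IsTheta a b (lim (Π< (thetaFactor a b)))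
  IsTheta-exists {a} {b} va vb = product-complete λ i →
    ≈[]-trans (≈[]-* (≈[]-trans (≈[]-* (V-1+ (V-* va (V-^ vab i))) (V-1+ (V-* vb (V-^ vab i))))
        (≈⇒≈[] (*-identityˡ 1#)))
                     (V-1- (V-^ vab (suc i))))
              (≈⇒≈[] (*-identityˡ 1#))
    where vab = V-*ˡ a vb

-- Positive cones and the positivity of theta quotients

-- Models the series in q^3 with nonnegative coefficients; closure under limits admits infinite
-- products and theta series.
record Cone {R : CommutativeRing 0ℓ 0ℓ} (F : Filtration R) : Set₁ where
  open CommutativeRing R
  open Limits F
  field
    K      : Carrier → Set
    K-resp : ∀ {x y} → x ≈ y → K x → K y
    K-0    : K 0#
    K-1    : K 1#
    K-+    : ∀ {x y} → K x → K y → K (x + y)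
    K-*    : ∀ {x y} → K x → K y → K (x * y)
    K-lim  : ∀ {s x} → (∀ n → K (s n)) → s ⟶ x → K x

module ThetaQuotients {R : CommutativeRing 0ℓ 0ℓ} {F : Filtration R} (C : Complete F)
  (q : CommutativeRing.Carrier R) (Vq : Filtration.V F 1 q) (cone : Cone F)
  (Kq³ : Cone.K cone (RawSemiringDefs._^_ (Semiring.rawSemiring (CommutativeRing.semiring R)) q 3))
      where
  open CommutativeRing R hiding (zero)
  open Filtration F
  open Limits F
  open Complete C
  open Cone cone
  open Theta F
  open Dissections F using (^-double; IsTheta-cong; theta-3-dissection; theta-2-dissection)
  open DualNumbers F using (dualRing; dualFiltration; ⟶-pair; HasProduct-log)
  open Products C q Vq
  open RingSolving R
  open import Algebra.Properties.Semiring.Exp semiring using (_^_; ^-homo-*; ^-congˡ; ^-assocʳ)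
  open import Algebra.Properties.CommutativeSemiring.Exp commutativeSemiring using (^-distrib-*)
  open import Relation.Binary.Reasoning.Setoid setoid

  K-^ : ∀ {x} → K x → ∀ n → K (x ^ n)
  K-^ k zero    = K-1
  K-^ k (suc n) = K-* k (K-^ k n)

  K-Σ : ∀ {u} → (∀ i → K (u i)) → ∀ n → K (Σ< u n)
  K-Σ k zero    = K-0
  K-Σ k (suc n) = K-+ (K-Σ k n) (k n)

  K-Π : ∀ {u} → (∀ i → K (u i)) → ∀ n → K (Π< u n)
  K-Π k zero    = K-1
  K-Π k (suc n) = K-* (K-Π k n) (k n)

  K-q^3* : ∀ n → K (q ^ (3 ℕ.* n))
  K-q^3* n = K-resp (^-assocʳ q 3 n) (K-^ Kq³ n)

  K-power : ∀ c d i → K (power (3 ℕ.* c) (3 ℕ.* d) i)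
  K-power c d i = K-* (K-q^3* c) (K-^ (K-q^3* d) i)

  K-geo : ∀ {x} → V 1 x → K x → K (geo x)
  K-geo v k = K-lim (λ n → K-Σ (K-^ k) (suc n)) (geo-sum v)

  -- For power series the second condition says that the constant term is 1.
  K₁ : Carrier → Set
  K₁ x = K x × x ≈[ 1 ] 1#

  K₁-* : ∀ {x y} → K₁ x → K₁ y → K₁ (x * y)
  K₁-* (k , v) (k′ , v′) = K-* k k′ , ≈[]-trans (≈[]-* v v′) (≈⇒≈[] (*-identityˡ 1#))

  K₁-resp : ∀ {x y} → x ≈ y → K₁ x → K₁ y
  K₁-resp e (k , v) = K-resp e k , ≈[]-trans (≈⇒≈[] (sym e)) v

  module _ (c d : ℕ) .{{_ : NonZero (3 ℕ.* c)}} .{{_ : NonZero (3 ℕ.* d)}} where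

    K₁-ipoch : K₁ (ipoch (3 ℕ.* c) (3 ℕ.* d))
    K₁-ipoch =
      K-lim (K-Π (λ i → K-geo (V-power (3 ℕ.* c) (3 ℕ.* d) i) (K-power c d i)))
          (ipoch-product (3 ℕ.* c) (3 ℕ.* d)) ,
      HasProduct-near (λ i → V-geo (V-power (3 ℕ.* c) (3 ℕ.* d) i) (V-power (3 ℕ.* c) (3 ℕ.* d) i))
          (ipoch-product (3 ℕ.* c) (3 ℕ.* d))

    K₁-npoch : K₁ (npoch (3 ℕ.* c) (3 ℕ.* d))
    K₁-npoch =
      K-lim (K-Π (λ i → K-+ K-1 (K-power c d i))) (npoch-product (3 ℕ.* c) (3 ℕ.* d)) ,
      HasProduct-near (λ i → V-1+ (V-power (3 ℕ.* c) (3 ℕ.* d) i))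
          (npoch-product (3 ℕ.* c) (3 ℕ.* d))

  K-w : ∀ {a b} → K a → K b → ∀ n → K (w a b n)
  K-w ka kb zero    = K-1
  K-w ka kb (suc n) = K-* (K-w ka kb n) (K-* ka (K-^ (K-* ka kb) n))

  -- The product side contains factors 1 - (a b)^i, whose coefficients are not all nonnegative.
  -- Positivity is seen only on the series side of the triple product.
  K-theta : ∀ {a b x} → V 1 (a * b) → K a → K b → IsTheta a b x → K x
  K-theta {a} {b} v ka kb t = K-lim (λ n → K-Σ term (suc n)) (TripleProduct.tripleProduct a b v t)
    where
    term : ∀ n → K (thetaTerm a b n)
    term zero    = K-1
    term (suc n) = K-+ (K-w ka kb (suc n)) (K-w kb ka (suc n))

  -- For power series this forces positive coefficients at all multiples of 3.
  Strict : Carrier → Set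
  Strict g = K g × K₁ ((1# - q ^ 3) * g)

  unroll : ∀ g → g ≈ (1# - q ^ 3) * g + q ^ 3 * g
  unroll = solve 2 (λ z g → g := (:1 :- z) :* g :+ z :* g) refl (q ^ 3)

  Strict-* : ∀ {g k} → Strict g → K₁ k → Strict (g * k)
  Strict-* (kg , k₁) k = K-* kg (proj₁ k) , K₁-resp (*-assoc _ _ _) (K₁-* k₁ k)

  Strict-resp : ∀ {g h} → g ≈ h → Strict g → Strict h
  Strict-resp e (k , k₁) = K-resp e k , K₁-resp (*-congˡ e) k₁

  -- `Strict` fixes a constant term and so is not closed under sums. One strict summand suffices,
  -- and the remaining ones need only lie in the cone.
  Positive : Carrier → Set
  Positive x = ∃[ g ] ∃[ h ] Strict g × K h × x ≈ g + h

  Split : Carrier → Set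
  Split x = ∃[ g ] ∃[ h ] Positive g × Positive h × x ≈ g - q * h

  Strict⇒Positive : ∀ {g} → Strict g → Positive g
  Strict⇒Positive s = _ , 0# , s , K-0 , sym (+-identityʳ _)

  cancelʳ : ∀ {u v x y} → u * v ≈ 1# → x * u ≈ y → x ≈ y * v
  cancelʳ {u} {v} {x} {y} e e′ = begin
    x            ≈⟨ *-identityʳ x ⟨
    x * 1#       ≈⟨ *-congˡ e ⟨
    x * (u * v)  ≈⟨ *-assoc x u v ⟨
    x * u * v    ≈⟨ *-congʳ e′ ⟩
    y * v        ∎

  -- 1 / f₃ and f₉ / f₃
  p H : Carrier
  p = ipoch 3 3
  H = ipoch 3 9 * ipoch 6 9

  p≈H/f₉ : p ≈ H * ipoch 9 9
  p≈H/f₉ = inverse-unique (poch-ipoch 3 3) (begin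
    poch 3 3 * (ipoch 3 9 * ipoch 6 9 * ipoch 9 9)
      ≈⟨ *-congʳ (poch-triple 3 3) ⟩
    poch 3 9 * poch 6 9 * poch 9 9 * (ipoch 3 9 * ipoch 6 9 * ipoch 9 9)
      ≈⟨ solve 6 (λ a b c x y z → a :* b :* c :* (x :* y :* z) := a :* x :* (b :* y) :* (c :* z))
          refl _ _ _ _ _ _ ⟩
    poch 3 9 * ipoch 3 9 * (poch 6 9 * ipoch 6 9) * (poch 9 9 * ipoch 9 9)
      ≈⟨ *-cong (*-cong (poch-ipoch 3 9) (poch-ipoch 6 9)) (poch-ipoch 9 9) ⟩
    1# * 1# * 1#
      ≈⟨ solve 0 (:1 :* :1 :* :1 := :1) refl ⟩
    1# ∎)

  f₉p≈H : poch 9 9 * p ≈ H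
  f₉p≈H = begin
    poch 9 9 * p                 ≈⟨ *-congˡ p≈H/f₉ ⟩
    poch 9 9 * (H * ipoch 9 9)   ≈⟨ solve 3 (λ x y z → x :* (y :* z) := y :* (x :* z)) refl _ _ _ ⟩
    H * (poch 9 9 * ipoch 9 9)   ≈⟨ *-congˡ (poch-ipoch 9 9) ⟩
    H * 1#                       ≈⟨ *-identityʳ H ⟩
    H                            ∎

  Strict-H : Strict H
  Strict-H = Strict-*
    -- Multiplication by 1 - q^3 removes the first factor of `ipoch 3 9` and leaves `ipoch 12 9`.
    (proj₁ (K₁-ipoch 1 3) , K₁-resp (sym (ipoch-head 3 9)) (K₁-ipoch 4 3))
    (K₁-ipoch 2 3)

  Strict-p : Strict p
  Strict-p = Strict-resp (sym p≈H/f₉) (Strict-* Strict-H (K₁-ipoch 3 3))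

  K₁-H : K₁ H
  K₁-H = K₁-* (K₁-ipoch 1 3) (K₁-ipoch 2 3)

  -- The theta functions f(-q^9,-q^9) and f(-q^3,-q^15).
  φ₉ Ω₃ : Carrier
  φ₉ = poch 9 18 * poch 9 18 * poch 18 18
  Ω₃ = poch 3 18 * poch 15 18 * poch 18 18

  f₃≈Ω₃ : Ω₃ * (poch 6 18 * poch 9 18 * poch 12 18) ≈ poch 3 3
  f₃≈Ω₃ = sym (begin
    poch 3 3
      ≈⟨ poch-triple 3 3 ⟩
    poch 3 9 * poch 6 9 * poch 9 9
      ≈⟨ *-cong (*-cong (poch-double 3 9) (poch-double 6 9)) (poch-double 9 9) ⟩
    poch 3 18 * poch 12 18 * (poch 6 18 * poch 15 18) * (poch 9 18 * poch 18 18)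
      ≈⟨ solve 6 (λ a b c d e f → a :* b :* (c :* d) :* (e :* f) := a :* d :* f :* (c :* e :* b))
          refl _ _ _ _ _ _ ⟩
    poch 3 18 * poch 15 18 * poch 18 18 * (poch 6 18 * poch 9 18 * poch 12 18) ∎)

  -- Ω₃ consists of the factors of f₃ with exponents 3, 15 and 0 modulo 18. They cancel against one
  -- copy of 1/f₃; the other copy stays whole and supplies strictness.
  Ω₃pp : Ω₃ * (p * p) ≈ p * (ipoch 6 18 * ipoch 9 18 * ipoch 12 18)
  Ω₃pp = begin
    Ω₃ * (p * p)
      ≈⟨ *-congʳ (cancelʳ inv f₃≈Ω₃) ⟩
    poch 3 3 * i * (p * p)
      ≈⟨ solve 3 (λ f i p → f :* i :* (p :* p) := f :* p :* (p :* i)) refl _ _ _ ⟩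
    poch 3 3 * p * (p * i)
      ≈⟨ *-congʳ (poch-ipoch 3 3) ⟩
    1# * (p * i)
      ≈⟨ *-identityˡ _ ⟩
    p * i ∎
    where
    i = ipoch 6 18 * ipoch 9 18 * ipoch 12 18
    inv : poch 6 18 * poch 9 18 * poch 12 18 * i ≈ 1#
    inv = begin
      poch 6 18 * poch 9 18 * poch 12 18 * (ipoch 6 18 * ipoch 9 18 * ipoch 12 18)
        ≈⟨ solve 6 (λ a b c x y z → a :* b :* c :* (x :* y :* z) := a :* x :* (b :* y) :* (c :* z))
            refl _ _ _ _ _ _ ⟩
      poch 6 18 * ipoch 6 18 * (poch 9 18 * ipoch 9 18) * (poch 12 18 * ipoch 12 18)
        ≈⟨ *-cong (*-cong (poch-ipoch 6 18) (poch-ipoch 9 18)) (poch-ipoch 12 18) ⟩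
      1# * 1# * 1#
        ≈⟨ solve 0 (:1 :* :1 :* :1 := :1) refl ⟩
      1# ∎

  Strict-Ω₃pp : Strict (Ω₃ * (p * p))
  Strict-Ω₃pp = Strict-resp (sym Ω₃pp)
    (Strict-* Strict-p (K₁-* (K₁-* (K₁-ipoch 2 6) (K₁-ipoch 3 6)) (K₁-ipoch 4 6)))

  Strict-φ₉pp : Strict (φ₉ * (p * p))
  Strict-φ₉pp = Strict-resp (sym eq) (Strict-* Strict-H (K₁-* K₁-H (K₁-ipoch 6 6)))
    where
    eq : φ₉ * (p * p) ≈ H * (H * ipoch 18 18)
    eq = begin
      φ₉ * (p * p)
        -- Multiplying φ₉ by f₁₈ makes it the square of f₉, so each f₉ can be paired with one 1/f₃.
        ≈⟨ *-congʳ (cancelʳ (poch-ipoch 18 18) refl) ⟩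
      φ₉ * poch 18 18 * ipoch 18 18 * (p * p)
        ≈⟨ solve 4 (λ a b i p → a :* a :* b :* b :* i :* (p :* p)
            := a :* b :* p :* (a :* b :* p :* i)) refl _ _ _ _ ⟩
      poch 9 18 * poch 18 18 * p * (poch 9 18 * poch 18 18 * p * ipoch 18 18)
        ≈⟨ *-cong f₉p (*-congʳ f₉p) ⟩
      H * (H * ipoch 18 18) ∎
      where
      f₉p : poch 9 18 * poch 18 18 * p ≈ H
      f₉p = trans (*-congʳ (sym (poch-double 9 9))) f₉p≈H

  -- The theta functions f(-q^9,-q^27) and f(-q^3,q^6).
  ψ₉ A₃ : Carrier
  ψ₉ = poch 27 36 * poch 9 36 * poch 36 36
  A₃ = poch 3 18 * npoch 6 18 * npoch 9 18 * (npoch 12 18 * poch 15 18 * poch 18 18)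

  Strict-ψ₉pp : Strict (ψ₉ * (p * p))
  Strict-ψ₉pp = Strict-resp (sym eq)
      (Strict-* Strict-H (K₁-* (K₁-ipoch 6 12) (proj₁ Strict-p , near-p)))
    where
    near-p : p ≈[ 1 ] 1#
    near-p = HasProduct-near (λ i → V-geo (V-power 3 3 i) (V-power 3 3 i)) (ipoch-product 3 3)
    f₉≈ : ψ₉ * poch 18 36 ≈ poch 9 9
    f₉≈ = sym (begin
      poch 9 9
        ≈⟨ poch-double 9 9 ⟩
      poch 9 18 * poch 18 18
        ≈⟨ *-cong (poch-double 9 18) (poch-double 18 18) ⟩
      poch 9 36 * poch 27 36 * (poch 18 36 * poch 36 36)
        ≈⟨ solve 4 (λ a b c d → a :* b :* (c :* d) := b :* a :* d :* c) refl _ _ _ _ ⟩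
      ψ₉ * poch 18 36 ∎)
    eq : ψ₉ * (p * p) ≈ H * (ipoch 18 36 * p)
    eq = begin
      ψ₉ * (p * p)                             ≈⟨ *-congʳ (cancelʳ (poch-ipoch 18 36) f₉≈) ⟩
      poch 9 9 * ipoch 18 36 * (p * p)        
          ≈⟨ solve 3 (λ f i p → f :* i :* (p :* p) := f :* p :* (i :* p)) refl _ _ _ ⟩
      poch 9 9 * p * (ipoch 18 36 * p)         ≈⟨ *-congʳ f₉p≈H ⟩
      H * (ipoch 18 36 * p)                    ∎

  Strict-A₃pp : Strict (A₃ * (p * p))
  Strict-A₃pp = Strict-resp
    (begin
      Ω₃ * (p * p) * (npoch 6 18 * npoch 9 18 * npoch 12 18)
        ≈⟨ solve 7 (λ a b c x y z p → a :* b :* c :* p :* (x :* y :* z)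
            := a :* x :* y :* (z :* b :* c) :* p) refl _ _ _ _ _ _ _ ⟩
      A₃ * (p * p) ∎)
    (Strict-* Strict-Ω₃pp (K₁-* (K₁-* (K₁-npoch 2 6) (K₁-npoch 3 6)) (K₁-npoch 4 6)))

  -- The base of this theta function is -q^9, whose powers alternate in sign. Pairing factors of
  -- even and odd index turns it into six products with base q^18. The second parameter is left as a
  -- product to fit `theta-2-dissection`.
  theta-A₃ : ∀ {x} → IsTheta (- (q ^ 3)) (- (q ^ 3) * - (q ^ 3)) x → x ≈ A₃
  theta-A₃ t = limit-unique (HasProduct-double t)
    (HasProduct-cong pointwise
      (HasProduct-*
        (HasProduct-* (HasProduct-* (poch-product 3 18) (npoch-product 6 18)) (npoch-product 9 18))
        (HasProduct-* (HasProduct-* (npoch-product 12 18) (poch-product 15 18))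
            (poch-product 18 18))))
    where
    Q = - (q ^ 3) * (- (q ^ 3) * - (q ^ 3))
    Q^double : ∀ j → Q ^ double j ≈ (q ^ 18) ^ j
    Q^double j = trans (^-double Q j) (trans (sym (^-distrib-* Q Q j))
      (^-congˡ j (solve 1 (λ q → let a = :- (q :^ 3); Q = a :* (a :* a) in Q :* Q := q :^ 18)
          refl q)))
    pointwise : ∀ j →
      (1# - power 3 18 j) * (1# + power 6 18 j) * (1# + power 9 18 j)
        * ((1# + power 12 18 j) * (1# - power 15 18 j) * (1# - power 18 18 j))
      ≈ thetaFactor (- (q ^ 3)) (- (q ^ 3) * - (q ^ 3)) (double j) * thetaFactor (- (q ^ 3))
          (- (q ^ 3) * - (q ^ 3)) (suc (double j))
    pointwise j = *-cong
      (*-cong (*-cong (trans (minus 3)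
          (solve 2 (λ q z → :1 :- (q :^ 3) :* z := :1 :+ :- (q :^ 3) :* z) refl q Z))
                      (trans (plus 6) (solve 2 (λ q z → :1 :+ (q :^ 6) :* z
                          := :1 :+ :- (q :^ 3) :* :- (q :^ 3) :* z) refl q Z)))
              (trans (plus 9) (solve 2 (λ q z → let a = :- (q :^ 3) in
                :1 :+ (q :^ 9) :* z := :1 :- a :* (a :* a) :* z) refl q Z)))
      (*-cong (*-cong (trans (plus 12) (solve 2 (λ q z → let a = :- (q :^ 3) in
                        :1 :+ (q :^ 12) :* z := :1 :+ a :* (a :* (a :* a) :* z)) refl q Z))
                      (trans (minus 15) (solve 2 (λ q z → let a = :- (q :^ 3) in
                        :1 :- (q :^ 15) :* z := :1 :+ a :* a :* (a :* (a :* a) :* z)) refl q Z)))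
              (trans (minus 18) (solve 2 (λ q z → let a = :- (q :^ 3); Q = a :* (a :* a) in
                :1 :- (q :^ 18) :* z := :1 :- Q :* (Q :* z)) refl q Z)))
      where
      Z = Q ^ double j
      plus : ∀ c → 1# + power c 18 j ≈ 1# + q ^ c * Z
      plus c = +-congˡ (*-congˡ (sym (Q^double j)))
      minus : ∀ c → 1# - power c 18 j ≈ 1# - q ^ c * Z
      minus c = +-congˡ (-‿cong (*-congˡ (sym (Q^double j))))

  inverse≈p : ∀ {f₃ g₃} → f₃ ≈ poch 3 3 → f₃ * g₃ ≈ 1# → g₃ ≈ p
  inverse≈p f₃≈ f₃g₃ = inverse-unique f₃g₃ (trans (*-congʳ f₃≈) (poch-ipoch 3 3))

  -- The numerators f₁²/f₂ and f₁f₄/f₂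

  module _ {f₁ f₂ f₃ f₄ g₂ g₃ : Carrier}
    (f₁≈ : f₁ ≈ poch 1 1) (f₂≈ : f₂ ≈ poch 2 2) (f₃≈ : f₃ ≈ poch 3 3) (f₄≈ : f₄ ≈ poch 4 4)
    (f₂g₂ : f₂ * g₂ ≈ 1#) (f₃g₃ : f₃ * g₃ ≈ 1#) where

    V-q^*q^ : ∀ m n .{{_ : NonZero n}} → V 1 (- (q ^ m) * - (q ^ n))
    V-q^*q^ m n = V-*ˡ _ (V-neg (Vq^ n))

    φ : Carrier
    φ = poch 1 2 * poch 1 2 * poch 2 2

    -- By the symmetry of f(-q,-q), the indices congruent to 1 and to -1 modulo 3 contribute
    -- equally, hence the doubled Ω₃.
    φ-dissection : φ ≈ φ₉ - q * (Ω₃ + Ω₃)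
    φ-dissection = begin
      φ
        ≈⟨ theta-3-dissection (- (q ^ 1)) (- (q ^ 1)) (V-q^*q^ 1 1) (IsTheta-poch 1 1)
             (IsTheta-cong q⁹ q⁹ (IsTheta-poch 9 9))
             (IsTheta-cong q¹⁵ q³ (IsTheta-poch 15 3))
             (IsTheta-cong q³ q¹⁵ (IsTheta-poch 3 15)) ⟩
      φ₉ + - (q ^ 1) * (poch 15 18 * poch 3 18 * poch 18 18) + - (q ^ 1) * Ω₃
        ≈⟨ solve 5 (λ q a b c x → x :+ :- (q :^ 1) :* (b :* a :* c) :+ :- (q :^ 1) :* (a :* b :* c)
              := x :- q :* (a :* b :* c :+ a :* b :* c))
                  refl q (poch 3 18) (poch 15 18) (poch 18 18) φ₉ ⟩
      φ₉ - q * (Ω₃ + Ω₃) ∎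
      where
      q³ = solve 1 (λ q → let a = :- (q :^ 1) in :- (q :^ 3) := a :* a :* a) refl q
      q⁹ = solve 1 (λ q → let a = :- (q :^ 1); c = a :* a :* a in :- (q :^ 9) := c :* c :* c) refl q
      q¹⁵ = solve 1 (λ q → let a = :- (q :^ 1); c = a :* a :* a in :- (q :^ 15)
          := c :* c :* c :* c :* c) refl q

    -- The trivial factors are kept because this is the form to which `a t` unfolds; g₂ and g₃ stand
    -- for the inverses of f₂ and f₃.
    split-f₁²/f₂f₃² : Split ((f₁ ^ 2) * ((g₂ ^ 1) * ((g₃ ^ 2) * ((f₄ ^ 0) * 1#))))
    split-f₁²/f₂f₃² = φ₉ * (p * p) , Ω₃ * (p * p) + Ω₃ * (p * p) ,
      Strict⇒Positive Strict-φ₉pp ,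
      (_ , _ , Strict-Ω₃pp , proj₁ Strict-Ω₃pp , refl) ,
      (begin
        (f₁ ^ 2) * ((g₂ ^ 1) * ((g₃ ^ 2) * ((f₄ ^ 0) * 1#)))
          ≈⟨ *-cong (^-congˡ 2 (trans f₁≈ (poch-double 1 1)))
              (*-congˡ (*-congʳ (^-congˡ 2 (inverse≈p f₃≈ f₃g₃)))) ⟩
        ((poch 1 2 * poch 2 2) ^ 2) * ((g₂ ^ 1) * ((p ^ 2) * ((f₄ ^ 0) * 1#)))
          ≈⟨ solve 5 (λ a b g p f → ((a :* b) :^ 2) :* ((g :^ 1) :* ((p :^ 2) :* ((f :^ 0) :* :1)))
               := a :* a :* b :* (p :* p) :* (b :* g)) refl _ _ _ _ f₄ ⟩
        φ * (p * p) * (poch 2 2 * g₂)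
          ≈⟨ *-cong (*-congʳ φ-dissection) (trans (*-congʳ (sym f₂≈)) f₂g₂) ⟩
        (φ₉ - q * (Ω₃ + Ω₃)) * (p * p) * 1#
          ≈⟨ solve 4 (λ x y p q → (x :- q :* (y :+ y)) :* p :* :1
              := x :* p :- q :* (y :* p :+ y :* p)) refl φ₉ Ω₃ (p * p) q ⟩
        φ₉ * (p * p) - q * (Ω₃ * (p * p) + Ω₃ * (p * p)) ∎)

    ψ : Carrier
    ψ = poch 1 4 * poch 3 4 * poch 4 4

    -- In f(-q,-q³) the indices congruent to 0 and to -1 modulo 3 both yield series in q^3. Neither
    -- their sum nor its positivity is visible as a product, so the 2-dissection is read backwards
    -- to recombine them into f(-q³,q⁶) = A₃.
    ψ-dissection : ψ ≈ A₃ - q * ψ₉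
    ψ-dissection = begin
      ψ
        ≈⟨ theta-3-dissection (- (q ^ 1)) (- (q ^ 3)) (V-q^*q^ 1 3) (IsTheta-poch 1 3)
             (IsTheta-cong q¹⁵ q²¹ (IsTheta-poch 15 21))
             (IsTheta-cong q²⁷ q⁹ (IsTheta-poch 27 9))
             (IsTheta-cong q³ q³³ (IsTheta-poch 3 33)) ⟩
      x₁ + - (q ^ 1) * ψ₉ + - (q ^ 3) * x₃
        ≈⟨ solve 4 (λ q x y z → x :+ :- (q :^ 1) :* y :+ :- (q :^ 3) :* z
            := x :+ :- (q :^ 3) :* z :- q :* y) refl q x₁ ψ₉ x₃ ⟩
      x₁ + - (q ^ 3) * x₃ - q * ψ₉
        ≈⟨ +-congʳ A₃-dissection ⟨
      A₃ - q * ψ₉ ∎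
      where
      x₁ = poch 15 36 * poch 21 36 * poch 36 36
      x₃ = poch 3 36 * poch 33 36 * poch 36 36
      q³ = solve 1 (λ q → let a = :- (q :^ 1) in :- (q :^ 3) := a :* a :* a) refl q
      q⁹ = solve 1 (λ q → let b = :- (q :^ 3) in :- (q :^ 9) := b :* b :* b) refl q
      q¹⁵ = solve 1 (λ q → let a = :- (q :^ 1); b = :- (q :^ 3); c = a :* a :* a; d = b :* b :* b in
              :- (q :^ 15) := c :* c :* d) refl q
      q²¹ = solve 1 (λ q → let a = :- (q :^ 1); b = :- (q :^ 3); c = a :* a :* a; d = b :* b :* b in
              :- (q :^ 21) := c :* d :* d) refl q
      q²⁷ = solve 1 (λ q → let a = :- (q :^ 1); b = :- (q :^ 3); c = a :* a :* a; d = b :* b :* b in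
              :- (q :^ 27) := c :* c :* c :* d :* d) refl q
      q³³ = solve 1 (λ q → let a = :- (q :^ 1); b = :- (q :^ 3); c = a :* a :* a; d = b :* b :* b in
              :- (q :^ 33) := c :* c :* d :* d :* d) refl q
      A₃-dissection : A₃ ≈ x₁ + - (q ^ 3) * x₃
      A₃-dissection = begin
        A₃
          ≈⟨ theta-A₃ exists ⟨
        _
          ≈⟨ theta-2-dissection (- (q ^ 3)) (- (q ^ 3)) (V-*ˡ _ (V-*ˡ _ (V-neg (Vq^ 3)))) exists
               (IsTheta-cong
                 (solve 1 (λ q → let a = :- (q :^ 3); a⁴ = a :* a :* a :* a in :- (q :^ 15)
                     := a⁴ :* a) refl q)
                 (solve 1 (λ q → let a = :- (q :^ 3); a⁴ = a :* a :* a :* a in :- (q :^ 21)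
                     := a⁴ :* a :* a :* a) refl q)
                 (IsTheta-poch 15 21))
               (IsTheta-cong
                 (solve 1 (λ q → let a = :- (q :^ 3); a⁴ = a :* a :* a :* a in :- (q :^ 33)
                     := a⁴ :* a⁴ :* a :* a :* a) refl q)
                 refl
                 (IsTheta-poch 33 3)) ⟩
        x₁ + - (q ^ 3) * (poch 33 36 * poch 3 36 * poch 36 36)
          ≈⟨ +-congˡ (*-congˡ (*-congʳ (*-comm _ _))) ⟩
        x₁ + - (q ^ 3) * x₃ ∎
        where exists = IsTheta-exists (V-neg (Vq^ 3)) (V-*ˡ (- (q ^ 3)) (V-neg (Vq^ 3)))

    split-f₁f₄/f₂f₃² : Split ((f₁ ^ 1) * ((g₂ ^ 1) * ((g₃ ^ 2) * ((f₄ ^ 1) * 1#))))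
    split-f₁f₄/f₂f₃² = A₃ * (p * p) , ψ₉ * (p * p) ,
      Strict⇒Positive Strict-A₃pp ,
      Strict⇒Positive Strict-ψ₉pp ,
      (begin
        (f₁ ^ 1) * ((g₂ ^ 1) * ((g₃ ^ 2) * ((f₄ ^ 1) * 1#)))
          ≈⟨ *-cong (^-congˡ 1 f₁-split) (*-congˡ
              (*-cong (^-congˡ 2 (inverse≈p f₃≈ f₃g₃)) (*-congʳ (^-congˡ 1 f₄≈)))) ⟩
        ((poch 1 4 * poch 3 4 * poch 2 2) ^ 1) * ((g₂ ^ 1) * ((p ^ 2) * ((poch 4 4 ^ 1) * 1#)))
          ≈⟨ solve 6 (λ a b c g p f → ((a :* b :* c) :^ 1) :*
              ((g :^ 1) :* ((p :^ 2) :* ((f :^ 1) :* :1)))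
               := a :* b :* f :* (p :* p) :* (c :* g)) refl _ _ _ _ _ _ ⟩
        ψ * (p * p) * (poch 2 2 * g₂)
          ≈⟨ *-cong (*-congʳ ψ-dissection) (trans (*-congʳ (sym f₂≈)) f₂g₂) ⟩
        (A₃ - q * ψ₉) * (p * p) * 1#
          ≈⟨ solve 4 (λ x y p q → (x :- q :* y) :* p :* :1 := x :* p :- q :* (y :* p))
              refl A₃ ψ₉ (p * p) q ⟩
        A₃ * (p * p) - q * (ψ₉ * (p * p)) ∎)
      where
      f₁-split : f₁ ≈ poch 1 4 * poch 3 4 * poch 2 2
      f₁-split = trans f₁≈ (trans (poch-double 1 1) (*-congʳ (poch-double 1 2)))

  -- The numerator f₁³ through dual numbers

  private
    module D  = CommutativeRing dualRing
    module DL = Limits dualFiltration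
    module DT = Theta dualFiltration
    module DD = Dissections dualFiltration
  open import Algebra.Properties.Semiring.Exp D.semiring using () renaming (_^_ to _^ᴰ_; ^-congˡ to ^ᴰ-congˡ)

  scalar-^ : ∀ x n → (x , 0#) ^ᴰ n D.≈ (x ^ n , 0#)
  scalar-^ x zero    = D.refl
  scalar-^ x (suc n) = D.trans (D.*-congˡ {x , 0#} (scalar-^ x n))
    (refl , solve 2 (λ x y → x :* :0 :+ :0 :* y := :0) refl x (x ^ n))

  -- The parameters -x z^k and -y z^(-k) with z = 1 + ε.
  left right : Carrier → Carrier → Carrier × Carrier
  left  k x = - x , - (k * x)
  right k y = - y , k * y

  left*right : ∀ k x y → left k x D.* right k y D.≈ (x * y , 0#)
  left*right k x y = solve 2 (λ x y → :- x :* :- y := x :* y) refl x y ,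
    solve 3 (λ k x y → :- x :* (k :* y) :+ :- (k :* x) :* :- y := :0) refl k x y

  thetaFactor-dual : ∀ k x y i → let z = (x * y) ^ i in
    DT.thetaFactor (left k x) (right k y) i D.≈
      ( (1# - x * z) * (1# - y * z) * (1# - (x * y) * z)
      , k * ((1# - x * z) * (y * z) - (1# - y * z) * (x * z)) * (1# - (x * y) * z))
  thetaFactor-dual k x y i = D.trans
    (D.*-cong (D.*-cong (D.+-congˡ {D.1#} (D.*-congˡ {left k x} (base i)))
        (D.+-congˡ {D.1#} (D.*-congˡ {right k y} (base i))))
              (D.+-congˡ {D.1#} (D.-‿cong (base (suc i)))))
    ( solve 3 (λ x y z → (:1 :+ :- x :* z) :* (:1 :+ :- y :* z) :* (:1 :- (x :* y) :* z)
         := (:1 :- x :* z) :* (:1 :- y :* z) :* (:1 :- (x :* y) :* z)) refl x y z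
    , solve 4 (λ k x y z →
         (:1 :+ :- x :* z) :* (:1 :+ :- y :* z) :* (:0 :+ :- :0)
         :+ ((:1 :+ :- x :* z) :* (:0 :+ (:- y :* :0 :+ k :* y :* z)) :+
             (:0 :+ (:- x :* :0 :+ :- (k :* x) :* z)) :* (:1 :+ :- y :* z))
              :* (:1 :- (x :* y) :* z)
         := k :* ((:1 :- x :* z) :* (y :* z) :- (:1 :- y :* z) :* (x :* z)) :*
             (:1 :- (x :* y) :* z)) refl k x y z)
    where
    z = (x * y) ^ i
    base : ∀ n → (left k x D.* right k y) ^ᴰ n D.≈ ((x * y) ^ n , 0#)
    base n = D.trans (^ᴰ-congˡ n (left*right k x y)) (scalar-^ (x * y) n)

  module _ (c d : ℕ) where

    lambert : ℕ → Carrier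
    lambert i = P * geo P - P′ * geo P′
      where
      P  = power c (c ℕ.+ d) i
      P′ = power d (c ℕ.+ d) i

    lambertSum : Carrier
    lambertSum = lim (Σ< lambert)

  module _ (c d : ℕ) .{{_ : NonZero c}} .{{_ : NonZero d}} where

    lambert-sum : Σ< (lambert c d) ⟶ lambertSum c d
    lambert-sum = sum-complete λ i → V-+ (V-resp (*-comm _ _) (V-*ˡ _ (power-order c (c ℕ.+ d) i)))
                                         (V-neg (V-resp (*-comm _ _) (V-*ˡ _
                                             (power-order d (c ℕ.+ d) i))))

    -- The logarithmic derivative of the product f(-q^c z^k, -q^d z^(-k)) at z = 1.
    IsTheta-dual : ∀ k → let P = poch c (c ℕ.+ d) * poch d (c ℕ.+ d) * poch (c ℕ.+ d) (c ℕ.+ d) in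
      DT.IsTheta (left k (q ^ c)) (right k (q ^ d)) (P , P * (- k * lambertSum c d))
    IsTheta-dual k = DL.HasProduct-cong pointwise
      (HasProduct-log
        (HasProduct-* (HasProduct-* (poch-product c (c ℕ.+ d)) (poch-product d (c ℕ.+ d)))
            (poch-product (c ℕ.+ d) (c ℕ.+ d)))
        (⟶-resp (Σ<-*ˡ (- k) (lambert c d)) (⟶-* (⟶-const (- k)) lambert-sum)))
      where
      pointwise : ∀ i → let u = (1# - power c (c ℕ.+ d) i) * (1# - power d (c ℕ.+ d) i) * (1# - power (c ℕ.+ d) (c ℕ.+ d) i) in
        (u , u * (- k * lambert c d i)) D.≈ DT.thetaFactor (left k (q ^ c)) (right k (q ^ d)) i
      pointwise i = D.trans
        ( *-cong (*-cong (+-congˡ (-‿cong (*-congˡ base))) (+-congˡ (-‿cong (*-congˡ base))))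
            (+-congˡ (-‿cong e))
        , (begin
            (1# - x) * (1# - y) * (1# - t) * (- k * (x * geo x - y * geo y))
              ≈⟨ solve 6 (λ x y t k g h → (:1 :- x) :* (:1 :- y) :* (:1 :- t) :*
                  (:- k :* (x :* g :- y :* h))
                   := k :* ((:1 :- x) :* y :* ((:1 :- y) :* h) :- (:1 :- y) :* x :*
                       ((:1 :- x) :* g)) :* (:1 :- t)) refl x y t k (geo x) (geo y) ⟩
            k * ((1# - x) * y * ((1# - y) * geo y) - (1# - y) * x * ((1# - x) * geo x)) * (1# - t)
              ≈⟨ *-congʳ (*-congˡ (+-cong (*-congˡ (geo-inverse (V-power d (c ℕ.+ d) i)))
                  (-‿cong (*-congˡ (geo-inverse (V-power c (c ℕ.+ d) i)))))) ⟩
            k * ((1# - x) * y * 1# - (1# - y) * x * 1#) * (1# - t)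
              ≈⟨ *-cong (*-congˡ (+-cong (trans (*-identityʳ _)
                  (*-cong (+-congˡ (-‿cong (*-congˡ base))) (*-congˡ base)))
                   (-‿cong (trans (*-identityʳ _) (*-cong (+-congˡ (-‿cong (*-congˡ base)))
                       (*-congˡ base)))))) (+-congˡ (-‿cong e)) ⟩
            k * ((1# - q ^ c * z) * (q ^ d * z) - (1# - q ^ d * z) * (q ^ c * z)) *
                (1# - q ^ c * q ^ d * z) ∎))
        (D.sym (thetaFactor-dual k (q ^ c) (q ^ d) i))
        where
        x = power c (c ℕ.+ d) i
        y = power d (c ℕ.+ d) i
        t = power (c ℕ.+ d) (c ℕ.+ d) i
        z = (q ^ c * q ^ d) ^ i
        base : (q ^ (c ℕ.+ d)) ^ i ≈ z
        base = ^-congˡ i (^-homo-* q c d)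
        e : t ≈ q ^ c * q ^ d * z
        e = *-cong (^-homo-* q c d) base

  module _ (c : ℕ) .{{_ : NonZero c}} where

    -- Jacobi's f(-z^k, -q^c z^(-k)) vanishes at z = 1 with derivative -k (q^c;q^c)³.
    IsTheta-jacobi : ∀ k → DT.IsTheta (left k 1#) (right k (q ^ c))
        (0# , - k * (poch c c * poch c c * poch c c))
    IsTheta-jacobi k = DL.⟶-unsuc (DL.⟶-resp (λ N → D.sym (finite N))
      (⟶-pair (⟶-const 0#) (⟶-* (⟶-const (- k))
        (⟶-* (⟶-* (poch-product c c) (⟶-subseq suc ℕ.n≤1+n (poch-product c c)))
            (⟶-subseq suc ℕ.n≤1+n (poch-product c c))))))
      where
      m : ℕ → Carrier
      m i = 1# - power c c i
      z^ : ∀ i → (1# * q ^ c) ^ i ≈ (q ^ c) ^ i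
      z^ i = ^-congˡ i (*-identityˡ (q ^ c))
      -- The factor 1 - z^k at index 0 supplies -k ε, so afterwards only the scalar parts of the
      -- factors matter. Without it the first of the three families runs one index behind the
      -- others, hence `Π< m N` beside `Π< m (suc N)`.
      finite : ∀ N → DL.Π< (DT.thetaFactor (left k 1#) (right k (q ^ c))) (suc N) D.≈
          (0# , - k * (Π< m N * Π< m (suc N) * Π< m (suc N)))
      finite zero = D.trans (D.*-congˡ {D.1#} (thetaFactor-dual k 1# (q ^ c) 0))
        ( solve 1 (λ x → :1 :* ((:1 :- :1 :* :1) :* (:1 :- x :* :1) :* (:1 :- :1 :* x :* :1)) := :0)
            refl (q ^ c)
        , solve 2 (λ k x → let m = :1 :- x :* :1 in
            :1 :* (k :* ((:1 :- :1 :* :1) :* (x :* :1) :- m :* (:1 :* :1)) :* (:1 :- :1 :* x :* :1))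
              :+ :0 :* ((:1 :- :1 :* :1) :* (:1 :- x :* :1) :* (:1 :- :1 :* x :* :1))
            := :- k :* (:1 :* (:1 :* m) :* (:1 :* m))) refl k (q ^ c))
      finite (suc N) = D.trans (D.*-cong (finite N) (thetaFactor-dual k 1# (q ^ c) (suc N)))
        ( zeroˡ _
        , trans (+-cong (zeroˡ _) (*-congˡ (*-cong (*-cong
              (+-congˡ (-‿cong (trans (*-identityˡ _) (z^ (suc N)))))
              (+-congˡ (-‿cong (*-congˡ (z^ (suc N))))))
              (+-congˡ (-‿cong (*-cong (*-identityˡ _) (z^ (suc N))))))))
            (solve 4 (λ k s m m′ → :0 :+ (:- k :* (s :* (s :* m) :* (s :* m))) :* (m :* m′ :* m′)
              := :- k :* (s :* m :* (s :* m :* m′) :* (s :* m :* m′)))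
                  refl k (Π< m N) (m N) (m (suc N))))

  three : Carrier
  three = 1# + 1# + 1#

  L : Carrier
  L = lambertSum 3 6

  F₃ : Carrier
  F₃ = poch 3 9 * poch 6 9 * poch 9 9

  module DualPolynomials where
    infixl 7 _·ₚ_
    -- Dual-number multiplication on solver expressions, so that both components of the dissected
    -- parameters can be checked by `solve`.
    _·ₚ_ : Polynomial 1 × Polynomial 1 → Polynomial 1 × Polynomial 1 → Polynomial 1 × Polynomial 1
    (a , b) ·ₚ (c , d) = a :* c , a :* d :+ b :* c

    a³ b³ leftₚ³ rightₚ⁶ leftₚ⁶ rightₚ⁹ : Polynomial 1 → Polynomial 1 × Polynomial 1
    a³ q = a ·ₚ a ·ₚ a where a = :- :1 , :- (:1 :* :1)
    b³ q = b ·ₚ b ·ₚ b where b = :- (q :^ 1) , :1 :* (q :^ 1)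
    leftₚ³  q = a³ q ·ₚ a³ q ·ₚ b³ q
    rightₚ⁶ q = a³ q ·ₚ b³ q ·ₚ b³ q
    leftₚ⁶  q = a³ q ·ₚ a³ q ·ₚ a³ q ·ₚ b³ q ·ₚ b³ q
    rightₚ⁹ q = a³ q ·ₚ a³ q ·ₚ b³ q ·ₚ b³ q ·ₚ b³ q
    :3 : Polynomial 1
    :3 = :1 :+ :1 :+ :1

  -- The ε-part of the 3-dissection at a = -(1 + ε), b = -q (1 - ε). The first two series equal f₃
  -- at ε = 0 and have logarithmic derivatives -3L and 3L. The second carries the prefactor a = -(1
  -- + ε), so together they give -6 f₃ L, and the ε of the prefactor gives -f₃. The third vanishes
  -- at ε = 0 and has derivative -3 f₉³. Cubing a and b turns ε into 3ε, the source of the threes.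
  cube-dissection : poch 1 1 * poch 1 1 * poch 1 1 ≈ F₃ * (1# + (three + three) * L) - q *
      (three * (poch 9 9 * poch 9 9 * poch 9 9))
  cube-dissection = begin
    c₁
      ≈⟨ solve 1 (λ x → x := :- (:- :1 :* x)) refl c₁ ⟩
    - (- 1# * c₁)
      ≈⟨ -‿cong (proj₂ (DD.theta-3-dissection a b Vab (IsTheta-jacobi 1 1#)
           (DD.IsTheta-cong
             (solve 1 (λ q → :- (q :^ 3) := proj₁ (leftₚ³ q))
                 refl q , solve 1 (λ q → :- (:3 :* (q :^ 3)) := proj₂ (leftₚ³ q)) refl q)
             (solve 1 (λ q → :- (q :^ 6) := proj₁ (rightₚ⁶ q))
                 refl q , solve 1 (λ q → :3 :* (q :^ 6) := proj₂ (rightₚ⁶ q)) refl q)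
             (IsTheta-dual 3 6 three))
           (DD.IsTheta-cong
             (solve 1 (λ q → :- (q :^ 6) := proj₁ (leftₚ⁶ q))
                 refl q , solve 1 (λ q → :- :3 :* (q :^ 6) := proj₂ (leftₚ⁶ q)) refl q)
             (solve 1 (λ q → :- (q :^ 3) := proj₁ (b³ q))
                 refl q , solve 1 (λ q → :- (:- :3 :* (q :^ 3)) := proj₂ (b³ q)) refl q)
             -- The second series has parameters -q^6 (1 + 3ε) and -q^3 (1 - 3ε): those of the first
             -- series in reverse order, with ε replaced by -ε.
             (DD.IsTheta-swap (IsTheta-dual 3 6 (- three))))
           (DD.IsTheta-cong
             (solve 1 (λ q → :- :1 := proj₁ (a³ q)) refl q , solve 1 (λ q → :- (:3 :* :1)
                 := proj₂ (a³ q)) refl q)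
             (solve 1 (λ q → :- (q :^ 9) := proj₁ (rightₚ⁹ q))
                 refl q , solve 1 (λ q → :3 :* (q :^ 9) := proj₂ (rightₚ⁹ q)) refl q)
             (IsTheta-jacobi 9 three)))) ⟩
    - (F₃ * (- three * L) + (- 1# * (F₃ * (- - three * L)) + - (1# * 1#) * F₃) +
        (- (q ^ 1) * (- three * c₉) + (1# * q ^ 1) * 0#))
      ≈⟨ solve 4 (λ q f l c → let t = :1 :+ :1 :+ :1 in
           :- (f :* (:- t :* l) :+ (:- :1 :* (f :* (:- (:- t) :* l)) :+ :- (:1 :* :1) :* f) :+
               (:- (q :^ 1) :* (:- t :* c) :+ (:1 :* (q :^ 1)) :* :0))
           := f :* (:1 :+ (t :+ t) :* l) :- q :* (t :* c)) refl q F₃ L c₉ ⟩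
    F₃ * (1# + (three + three) * L) - q * (three * c₉) ∎
    where
    open DualPolynomials
    a = left 1# 1#
    b = right 1# (q ^ 1)
    c₁ = poch 1 1 * poch 1 1 * poch 1 1
    c₉ = poch 9 9 * poch 9 9 * poch 9 9
    Vab : Filtration.V dualFiltration 1 (a D.* b)
    Vab = Filtration.V-resp dualFiltration (D.sym (left*right 1# 1# (q ^ 1)))
        (V-*ˡ 1# (Vq^ 1) , V-0# 1)

  K-Lp : K (L * p)
  K-Lp = K-lim (K-Σ K-term)
    (⟶-resp (λ n → trans (*-comm _ _) (Σ<-*ˡ p (lambert 3 6) n))
        (⟶-* (lambert-sum 3 6) (⟶-const p)))
    where
    -- x/(1-x) - y/(1-y) = x(1-q³)/((1-x)(1-y)) for y = q³x, and p absorbs the factor 1-q³.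
    K-term : ∀ i → K (p * lambert 3 6 i)
    K-term i = K-resp (sym (begin
        p * (x * geo x - y * geo y)
          ≈⟨ *-congˡ (+-cong (insert (V-power 6 9 i) (x * geo x))
              (-‿cong (insert (V-power 3 9 i) (y * geo y)))) ⟩
        p * (x * geo x * ((1# - y) * geo y) - y * geo y * ((1# - x) * geo x))
          ≈⟨ solve 5 (λ p x y g h → p :* (x :* g :* ((:1 :- y) :* h) :- y :* h :* ((:1 :- x) :* g))
               := p :* (g :* h) :* (x :- y)) refl p x y (geo x) (geo y) ⟩
        p * (geo x * geo y) * (x - y)
          ≈⟨ *-congˡ (+-congˡ (-‿cong (trans (*-congʳ (^-homo-* q 3 3)) (*-assoc _ _ _)))) ⟩
        p * (geo x * geo y) * (x - q ^ 3 * x)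
          ≈⟨ solve 4 (λ p x z g → p :* g :* (x :- z :* x) := (:1 :- z) :* p :* (x :* g))
              refl p x (q ^ 3) (geo x * geo y) ⟩
        (1# - q ^ 3) * p * (x * (geo x * geo y)) ∎))
      (K-* (proj₁ (proj₂ Strict-p)) (K-* (K-power 1 3 i)
          (K-* (K-geo (V-power 3 9 i) (K-power 1 3 i)) (K-geo (V-power 6 9 i) (K-power 2 3 i)))))
      where
      x = power 3 9 i
      y = power 6 9 i
      insert : ∀ {t} → V 1 t → ∀ s → s ≈ s * ((1# - t) * geo t)
      insert v s = sym (trans (*-congˡ (geo-inverse v)) (*-identityʳ s))

  -- f₉³/f₃² = (f₉/f₃) f(q³,q⁶) / ((q⁶;q¹⁸)∞ (q¹²;q¹⁸)∞)
  Strict-f₉³pp : Strict (poch 9 9 * poch 9 9 * poch 9 9 * (p * p))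
  Strict-f₉³pp = Strict-resp (sym eq)
      (Strict-* Strict-H (K₁-* K₁-A (K₁-* (K₁-ipoch 2 6) (K₁-ipoch 4 6))))
    where
    A = npoch 3 9 * npoch 6 9 * poch 9 9
    K₁-A : K₁ A
    K₁-A = K-theta (V-*ˡ (q ^ 3) (Vq^ 6)) (K-q^3* 1) (K-q^3* 2) (IsTheta-npoch 3 6) ,
      ≈[]-trans (≈[]-* (proj₂ (K₁-* (K₁-npoch 1 3) (K₁-npoch 2 3))) (poch-near-1 9 9))
          (≈⇒≈[] (*-identityˡ 1#))
    eq : poch 9 9 * poch 9 9 * poch 9 9 * (p * p) ≈ H * (A * (ipoch 6 18 * ipoch 12 18))
    eq = begin
      poch 9 9 * poch 9 9 * poch 9 9 * (p * p)
        ≈⟨ solve 2 (λ f p → f :* f :* f :* (p :* p) := f :* p :* (f :* p :* f)) refl _ _ ⟩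
      poch 9 9 * p * (poch 9 9 * p * poch 9 9)
        ≈⟨ *-cong f₉p≈H (*-congʳ f₉p≈H) ⟩
      H * (ipoch 3 9 * ipoch 6 9 * poch 9 9)
        ≈⟨ *-congˡ (*-congʳ (*-cong (cancelʳ (poch-ipoch 6 18) (quotient 3))
            (cancelʳ (poch-ipoch 12 18) (quotient 6)))) ⟩
      H * (npoch 3 9 * ipoch 6 18 * (npoch 6 9 * ipoch 12 18) * poch 9 9)
        ≈⟨ solve 6 (λ h a b c x y → h :* (a :* x :* (b :* y) :* c)
            := h :* (a :* b :* c :* (x :* y))) refl _ _ _ _ _ _ ⟩
      H * (A * (ipoch 6 18 * ipoch 12 18)) ∎
      where
      quotient : ∀ c .{{_ : NonZero c}} → ipoch c 9 * poch (c ℕ.+ c) 18 ≈ npoch c 9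
      quotient c = begin
        ipoch c 9 * poch (c ℕ.+ c) 18           ≈⟨ *-congˡ (npoch-poch c 9) ⟨
        ipoch c 9 * (npoch c 9 * poch c 9)     
            ≈⟨ solve 3 (λ i n p → i :* (n :* p) := n :* (p :* i)) refl _ _ _ ⟩
        npoch c 9 * (poch c 9 * ipoch c 9)      ≈⟨ *-congˡ (poch-ipoch c 9) ⟩
        npoch c 9 * 1#                          ≈⟨ *-identityʳ _ ⟩
        npoch c 9                               ∎

  module _ {f₁ f₂ f₃ f₄ g₃ : Carrier}
    (f₁≈ : f₁ ≈ poch 1 1) (f₃≈ : f₃ ≈ poch 3 3) (f₃g₃ : f₃ * g₃ ≈ 1#) where

    split-f₁³/f₃² : Split ((f₁ ^ 3) * ((f₂ ^ 0) * ((g₃ ^ 2) * ((f₄ ^ 0) * 1#))))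
    split-f₁³/f₃² = p + (three + three) * (L * p) , three * G ,
      (p , (three + three) * (L * p) , Strict-p , K-* (K-+ K-three K-three) K-Lp , refl) ,
      -- The constant term of 3G is 3, so one copy of G serves as the strict summand and the other
      -- two go to the cone.
      (G , (1# + 1#) * G , Strict-f₉³pp , K-* (K-+ K-1 K-1) (proj₁ Strict-f₉³pp) ,
        solve 1 (λ g → (:1 :+ :1 :+ :1) :* g := g :+ (:1 :+ :1) :* g) refl G) ,
      (begin
        (f₁ ^ 3) * ((f₂ ^ 0) * ((g₃ ^ 2) * ((f₄ ^ 0) * 1#)))
          ≈⟨ *-cong (^-congˡ 3 f₁≈) (*-congˡ (*-congʳ (^-congˡ 2 (inverse≈p f₃≈ f₃g₃)))) ⟩
        (poch 1 1 ^ 3) * ((f₂ ^ 0) * ((p ^ 2) * ((f₄ ^ 0) * 1#)))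
          ≈⟨ solve 4 (λ f g p h → (f :^ 3) :* ((g :^ 0) :* ((p :^ 2) :* ((h :^ 0) :* :1)))
              := f :* f :* f :* (p :* p)) refl (poch 1 1) f₂ p f₄ ⟩
        poch 1 1 * poch 1 1 * poch 1 1 * (p * p)
          ≈⟨ *-congʳ cube-dissection ⟩
        (F₃ * (1# + (three + three) * L) - q * (three * c₉)) * (p * p)
          ≈⟨ solve 6 (λ f p l q c t → (f :* (:1 :+ (t :+ t) :* l) :- q :* (t :* c)) :* (p :* p)
               := f :* p :* (p :+ (t :+ t) :* (l :* p)) :- q :* (t :* (c :* (p :* p))))
                   refl F₃ p L q c₉ three ⟩
        F₃ * p * (p + (three + three) * (L * p)) - q * (three * G)
          ≈⟨ +-congʳ (trans (*-congʳ (trans (*-congʳ (sym (poch-triple 3 3))) (poch-ipoch 3 3)))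
              (*-identityˡ _)) ⟩
        p + (three + three) * (L * p) - q * (three * G) ∎)
      where
      c₉ = poch 9 9 * poch 9 9 * poch 9 9
      G = c₉ * (p * p)
      K-three : K three
      K-three = K-+ (K-+ K-1 K-1) K-1

-- The complete filtered ring of integer power series

open import Data.Integer.Base using (_>_; _<_; +_; +≤+; +<+)
open import Data.List.Membership.Propositional using (_∈_)
open import Data.List.Relation.Unary.Any using (here; there)
open import Data.Nat.Base using (_+_; _*_)
open import Data.Vec.Base using (Vec)
open import Defs
open import Relation.Binary.PropositionalEquality

module ℤSolver = RingSolving ℤ.+-*-commutativeRing
open ℤSolver using (solve; _:=_; _:+_; _:*_; :0; :1)

⊛-cong : ∀ {g g′ h h′} → g ≗ g′ → h ≗ h′ → g ⊛ h ≗ g′ ⊛ h′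
⊛-cong eg eh zero    = cong₂ (λ x y → x ℤ.* y ℤ.+ 0ℤ) (eg 0) (eh 0)
⊛-cong eg eh (suc n) =
  cong₂ ℤ._+_ (cong₂ ℤ._*_ (eg 0) (eh (suc n))) (⊛-cong (eg ∘ suc) eh n)

⊛-distribʳ : ∀ k g h → (g ⊕ h) ⊛ k ≗ (g ⊛ k) ⊕ (h ⊛ k)
⊛-distribʳ k g h zero = solve 3 (λ x y z → (x :+ y) :* z :+ :0 := (x :* z :+ :0) :+ (y :* z :+ :0))
  refl (g 0) (h 0) (k 0)
⊛-distribʳ k g h (suc n) rewrite ⊛-distribʳ k (g ∘ suc) (h ∘ suc) n =
  solve 5 (λ x y z u v → (x :+ y) :* z :+ (u :+ v) := (x :* z :+ u) :+ (y :* z :+ v)) refl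
    (g 0) (h 0) (k (suc n)) _ _

⊛-scale : ∀ c g h → (λ n → c ℤ.* g n) ⊛ h ≗ λ n → c ℤ.* (g ⊛ h) n
⊛-scale c g h zero = solve 3 (λ x y z → x :* y :* z :+ :0 := x :* (y :* z :+ :0)) refl c (g 0) (h 0)
⊛-scale c g h (suc n) rewrite ⊛-scale c (g ∘ suc) h n =
  solve 4 (λ x y z u → x :* y :* z :+ x :* u := x :* (y :* z :+ u)) refl c (g 0) (h (suc n)) _

-- The convolution unfolds by peeling off `g 0`; this peels off `h 0` instead, the mirror image that
-- commutativity needs.
⊛-suc : ∀ g h n → (g ⊛ h) (suc n) ≡ (g ⊛ (h ∘ suc)) n ℤ.+ g (suc n) ℤ.* h 0
⊛-suc g h zero = solve 4 (λ x y z u → x :* y :+ (z :* u :+ :0) := (x :* y :+ :0) :+ z :* u) refl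
  (g 0) (h 1) (g 1) (h 0)
⊛-suc g h (suc n) rewrite ⊛-suc (g ∘ suc) h n = sym (ℤ.+-assoc (g 0 ℤ.* h (suc (suc n))) _ _)

⊛-comm : ∀ g h → g ⊛ h ≗ h ⊛ g
⊛-comm g h zero = cong (ℤ._+ 0ℤ) (ℤ.*-comm (g 0) (h 0))
⊛-comm g h (suc n) = begin
  g 0 ℤ.* h (suc n) ℤ.+ ((g ∘ suc) ⊛ h) n 
      ≡⟨ cong₂ ℤ._+_ (ℤ.*-comm (g 0) _) (⊛-comm (g ∘ suc) h n) ⟩
  h (suc n) ℤ.* g 0 ℤ.+ (h ⊛ (g ∘ suc)) n  ≡⟨ ℤ.+-comm (h (suc n) ℤ.* g 0) _ ⟩
  (h ⊛ (g ∘ suc)) n ℤ.+ h (suc n) ℤ.* g 0  ≡⟨ ⊛-suc h g n ⟨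
  (h ⊛ g) (suc n)                          ∎
  where open ≡-Reasoning

-- The tail of `g ⊛ h` is `g 0` times the tail of h plus the tail of g convolved with h; the
-- induction runs through distributivity and scaling.
⊛-assoc : ∀ g h k → (g ⊛ h) ⊛ k ≗ g ⊛ (h ⊛ k)
⊛-assoc g h k zero =
  solve 3 (λ x y z → (x :* y :+ :0) :* z :+ :0 := x :* (y :* z :+ :0) :+ :0) refl (g 0) (h 0) (k 0)
⊛-assoc g h k (suc n) = begin
  (g 0 ℤ.* h 0 ℤ.+ 0ℤ) ℤ.* k (suc n) ℤ.+ (((λ i → g 0 ℤ.* h (suc i)) ⊕ ((g ∘ suc) ⊛ h)) ⊛ k) n
    ≡⟨ cong (λ x → c ℤ.+ x) (⊛-distribʳ k (λ i → g 0 ℤ.* h (suc i)) ((g ∘ suc) ⊛ h) n) ⟩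
  (g 0 ℤ.* h 0 ℤ.+ 0ℤ) ℤ.* k (suc n)
    ℤ.+ (((λ i → g 0 ℤ.* h (suc i)) ⊛ k) n ℤ.+ (((g ∘ suc) ⊛ h) ⊛ k) n)
    ≡⟨ cong₂ (λ x y → c ℤ.+ (x ℤ.+ y)) (⊛-scale (g 0) (h ∘ suc) k n) (⊛-assoc (g ∘ suc) h k n) ⟩
  (g 0 ℤ.* h 0 ℤ.+ 0ℤ) ℤ.* k (suc n)
    ℤ.+ (g 0 ℤ.* ((h ∘ suc) ⊛ k) n ℤ.+ ((g ∘ suc) ⊛ (h ⊛ k)) n)
    ≡⟨ solve 5 (λ x y z u v → (x :* y :+ :0) :* z :+ (x :* u :+ v) := x :* (y :* z :+ u) :+ v) refl
         (g 0) (h 0) (k (suc n)) _ _ ⟩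
  g 0 ℤ.* (h ⊛ k) (suc n) ℤ.+ ((g ∘ suc) ⊛ (h ⊛ k)) n ∎
  where
  open ≡-Reasoning
  c = (g 0 ℤ.* h 0 ℤ.+ 0ℤ) ℤ.* k (suc n)

⊛-zeroˡ : ∀ g → (λ _ → 0ℤ) ⊛ g ≗ λ _ → 0ℤ
⊛-zeroˡ g zero    = refl
⊛-zeroˡ g (suc n) = trans (ℤ.+-identityˡ _) (⊛-zeroˡ g n)

⊛-identityˡ : ∀ g → q^ 0 ⊛ g ≗ g
⊛-identityˡ g zero    = solve 1 (λ x → :1 :* x :+ :0 := x) refl (g 0)
⊛-identityˡ g (suc n) rewrite ⊛-zeroˡ g n = solve 1 (λ x → :1 :* x :+ :0 := x) refl (g (suc n))

powerSeriesRing : CommutativeRing 0ℓ 0ℓ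
powerSeriesRing = record
  { Carrier = PowerSeries
  ; _≈_     = _≗_
  ; _+_     = _⊕_
  ; _*_     = _⊛_
  ; -_      = λ g n → ℤ.- g n
  ; 0#      = λ _ → 0ℤ
  ; 1#      = q^ 0
  ; isCommutativeRing = record
    { isRing = record
      { +-isAbelianGroup = record
        { isGroup = record
          { isMonoid = record
            { isSemigroup = record
              { isMagma = record
                { isEquivalence = record
                  { refl  = λ _ → refl
                  ; sym   = λ e n → sym (e n)
                  ; trans = λ e e′ n → trans (e n) (e′ n)
                  }
                ; ∙-cong = λ e e′ n → cong₂ ℤ._+_ (e n) (e′ n)
                }
              ; assoc = λ g h k n → ℤ.+-assoc (g n) (h n) (k n)
              }
            ; identity = (λ g n → ℤ.+-identityˡ (g n)) , (λ g n → ℤ.+-identityʳ (g n))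
            }
          ; inverse = (λ g n → ℤ.+-inverseˡ (g n)) , (λ g n → ℤ.+-inverseʳ (g n))
          ; ⁻¹-cong = λ e n → cong ℤ.-_ (e n)
          }
        ; comm = λ g h n → ℤ.+-comm (g n) (h n)
        }
      ; *-cong     = ⊛-cong
      ; *-assoc    = ⊛-assoc
      ; *-identity = ⊛-identityˡ , λ g n → trans (⊛-comm g (q^ 0) n) (⊛-identityˡ g n)
      ; distrib    = (λ k g h n → trans (⊛-comm k (g ⊕ h) n) (trans (⊛-distribʳ k g h n)
                                    (cong₂ ℤ._+_ (⊛-comm g k n) (⊛-comm h k n))))
                   , ⊛-distribʳ
      }
    ; *-comm = ⊛-comm
    }
  }

q^-shift : ∀ g n → (q^ 1 ⊛ g) (suc n) ≡ g n
q^-shift g n = trans (ℤ.+-identityˡ _) (⊛-identityˡ g n)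

q^-suc : ∀ m → q^ 1 ⊛ q^ m ≗ q^ suc m
q^-suc m zero    = refl
q^-suc m (suc n) = q^-shift (q^ m) n

VanishesBelow : ℕ → PowerSeries → Set
VanishesBelow n g = ∀ i → i ℕ.< n → g i ≡ 0ℤ

⊛-vanishes : ∀ m n {g h} → VanishesBelow m g → VanishesBelow n h → VanishesBelow (m ℕ.+ n) (g ⊛ h)
⊛-vanishes zero n {g} {h} _ vh zero 0<n rewrite vh 0 0<n = cong (ℤ._+ 0ℤ) (ℤ.*-zeroʳ (g 0))
⊛-vanishes zero n {g} {h} vg vh (suc i) i<n = cong₂ ℤ._+_
  (trans (cong (g 0 ℤ.*_) (vh (suc i) i<n)) (ℤ.*-zeroʳ (g 0)))
  (⊛-vanishes zero n {g ∘ suc} {h} (λ _ ()) vh i (ℕ.<-trans (ℕ.n<1+n i) i<n))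
⊛-vanishes (suc m) n {g} {h} vg vh zero _ = cong (λ x → x ℤ.* h 0 ℤ.+ 0ℤ) (vg 0 (s≤s z≤n))
⊛-vanishes (suc m) n {g} {h} vg vh (suc i) (s≤s i<m+n) = cong₂ ℤ._+_
  (cong (ℤ._* h (suc i)) (vg 0 (s≤s z≤n)))
  (⊛-vanishes m n (λ j j<m → vg (suc j) (s≤s j<m)) vh i i<m+n)

order : Filtration powerSeriesRing
order = record
  { V         = VanishesBelow
  ; V-resp    = λ e v i i<n → trans (sym (e i)) (v i i<n)
  ; V-all     = λ _ _ ()
  ; V-0#      = λ _ _ _ → refl
  ; V-+       = λ v v′ i i<n → cong₂ ℤ._+_ (v i i<n) (v′ i i<n)
  ; V-*       = λ {m} {n} → ⊛-vanishes m n
  ; V-anti    = λ m≤n v i i<m → v i (ℕ.<-≤-trans i<m m≤n)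
  ; separated = λ v i → v (suc i) i (ℕ.n<1+n i)
  }

open Filtration order
open Limits order

≈[]⇒≡ : ∀ {g h L} i → i ℕ.< L → g ≈[ L ] h → g i ≡ h i
≈[]⇒≡ {g} {h} i i<L v = ℤ.i-j≡0⇒i≡j (g i) (h i) (v i i<L)

≡⇒≈[] : ∀ {g h L} → (∀ i → i ℕ.< L → g i ≡ h i) → g ≈[ L ] h
≡⇒≈[] e i i<L = ℤ.i≡j⇒i-j≡0 (e i i<L)

-- Passing from s n to s (n + 1) keeps the coefficients up to index n, so coefficient i is final
-- from stage i on.
cauchy-limit : ∀ s → (∀ n → s (suc n) ≈[ suc n ] s n) → s ⟶ λ n → s n n
cauchy-limit s c L = L , λ n L≤n → ≡⇒≈[] λ i i<L → stable i (ℕ.≤⇒≤′ (ℕ.≤-trans (ℕ.<⇒≤ i<L) L≤n))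
  where
  stable : ∀ i {n} → i ℕ.≤′ n → s n i ≡ s i i
  stable i ℕ.≤′-refl = refl
  stable i (ℕ.≤′-step {n} p) = trans (≈[]⇒≡ {s (suc n)} {s n} {suc n} i (s≤s (ℕ.≤′⇒≤ p)) (c n))
      (stable i p)

order-complete : Complete order
order-complete = record { lim = λ s n → s n n ; complete = λ {s} → cauchy-limit s }

-- Nonnegative series in q³ and the sign pattern

NonNegative : PowerSeries → Set
NonNegative g = ∀ n → 0ℤ ℤ.≤ g n

InQ³ : PowerSeries → Set
InQ³ g = ∀ n → g (suc (triple n)) ≡ 0ℤ × g (suc (suc (triple n))) ≡ 0ℤ

*-nonNegative : ∀ {i j} → 0ℤ ℤ.≤ i → 0ℤ ℤ.≤ j → 0ℤ ℤ.≤ i ℤ.* j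
*-nonNegative {+ m} {+ n} _ _ rewrite sym (ℤ.pos-* m n) = +≤+ z≤n

⊛-nonNegative : ∀ {g h} → NonNegative g → NonNegative h → NonNegative (g ⊛ h)
⊛-nonNegative ng nh zero    = ℤ.+-mono-≤ (*-nonNegative (ng 0) (nh 0)) (ℤ.≤-refl {0ℤ})
⊛-nonNegative ng nh (suc n) = ℤ.+-mono-≤ (*-nonNegative (ng 0) (nh (suc n)))
    (⊛-nonNegative (ng ∘ suc) nh n)

-- If i + j is not divisible by 3, then i or j is not. The recursion strips three coefficients of g
-- at a time while h stays fixed, since a shift by three preserves `InQ³`.
⊛-inQ³ : ∀ {g h} → InQ³ g → InQ³ h → InQ³ (g ⊛ h)
⊛-inQ³ {g} {h} ig ih n = go₁ g ig n , go₂ g ig n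
  where
  go₁ : ∀ g → InQ³ g → ∀ n → (g ⊛ h) (suc (triple n)) ≡ 0ℤ
  go₁ g ig zero rewrite proj₁ (ig 0) | proj₁ (ih 0) =
    solve 2 (λ x y → x :* :0 :+ (:0 :* y :+ :0) := :0) refl (g 0) (h 0)
  go₁ g ig (suc n) rewrite proj₁ (ig 0) | proj₂ (ig 0) | proj₁ (ih (suc n)) | go₁ (λ i → g (3 + i))
      (ig ∘ suc) n =
    solve 3 (λ x y z → x :* :0 :+ (:0 :* y :+ (:0 :* z :+ :0)) := :0)
        refl (g 0) (h (3 + triple n)) (h (2 + triple n))
  go₂ : ∀ g → InQ³ g → ∀ n → (g ⊛ h) (suc (suc (triple n))) ≡ 0ℤ
  go₂ g ig zero rewrite proj₁ (ig 0) | proj₂ (ig 0) | proj₂ (ih 0) =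
    solve 3 (λ x y z → x :* :0 :+ (:0 :* y :+ (:0 :* z :+ :0)) := :0) refl (g 0) (h 1) (h 0)
  go₂ g ig (suc n) rewrite proj₁ (ig 0) | proj₂ (ig 0) | proj₂ (ih (suc n)) | go₂ (λ i → g (3 + i))
      (ig ∘ suc) n =
    solve 3 (λ x y z → x :* :0 :+ (:0 :* y :+ (:0 :* z :+ :0)) := :0)
        refl (g 0) (h (4 + triple n)) (h (3 + triple n))

q^0-nonNegative : NonNegative (q^ 0)
q^0-nonNegative zero    = +≤+ z≤n
q^0-nonNegative (suc n) = +≤+ z≤n

-- Every coefficient of a limit is attained at a finite stage, so conditions on single coefficients
-- pass to limits.
limit-coefficient : ∀ s x → s ⟶ x → ∀ n → ∃[ N ] s N n ≡ x n
limit-coefficient s x l n with l (suc n)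
... | N , e = N , ≈[]⇒≡ {s N} {x} {suc n} n (ℕ.n<1+n n) (e N ℕ.≤-refl)

nonNegInQ³ : Cone order
nonNegInQ³ = record
  { K      = λ g → NonNegative g × InQ³ g
  ; K-resp = λ e (ng , ig) → (λ n → subst (0ℤ ℤ.≤_) (e n) (ng n)) ,
      λ n → trans (sym (e _)) (proj₁ (ig n)) , trans (sym (e _)) (proj₂ (ig n))
  ; K-0    = (λ _ → +≤+ z≤n) , λ _ → refl , refl
  ; K-1    = q^0-nonNegative , λ _ → refl , refl
  ; K-+    = λ (ng , ig) (nh , ih) → (λ n → ℤ.+-mono-≤ (ng n) (nh n)) ,
      λ n → cong₂ ℤ._+_ (proj₁ (ig n)) (proj₁ (ih n)) , cong₂ ℤ._+_ (proj₂ (ig n)) (proj₂ (ih n))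
  ; K-*    = λ {g} {h} (ng , ig) (nh , ih) → ⊛-nonNegative {g} {h} ng nh , ⊛-inQ³ {g} {h} ig ih
  ; K-lim  = λ {s} {x} k l →
      (λ n → let N , e = limit-coefficient s x l n in subst (0ℤ ℤ.≤_) e (proj₁ (k N) n)) ,
      (λ n → (let N , e = limit-coefficient s x l (suc (triple n)) in trans (sym e)
          (proj₁ (proj₂ (k N) n)))
           , (let N , e = limit-coefficient s x l (suc (suc (triple n))) in trans (sym e)
               (proj₂ (proj₂ (k N) n))))
  }

q : PowerSeries
q = q^ 1

q-^ : ∀ n → q ^ n ≗ q^ n
q-^ zero    i = refl
q-^ (suc n) i = trans (⊛-cong {q} {q} {q ^ n} {q^ n} (λ _ → refl) (q-^ n) i) (q^-suc n i)

Vq : Filtration.V order 1 q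
Vq zero _ = refl
Vq (suc _) (s≤s ())

q^3-shift : ∀ g n → ((q ^ 3) ⊛ g) (suc (suc (suc n))) ≡ g n
q^3-shift g n = begin
  ((q ^ 3) ⊛ g) (3 + n)                
      ≡⟨ ⊛-cong {q ^ 3} {q^ 3} {g} {g} (q-^ 3) (λ _ → refl) (3 + n) ⟩
  ((q^ 3) ⊛ g) (3 + n)                 
      ≡⟨ trans (ℤ.+-identityˡ _) (trans (ℤ.+-identityˡ _) (ℤ.+-identityˡ _)) ⟩
  ((q^ 0) ⊛ g) n                        ≡⟨ ⊛-identityˡ g n ⟩
  g n                                   ∎
  where open ≡-Reasoning

Kq³ : Cone.K nonNegInQ³ (q ^ 3)
Kq³ = Cone.K-resp nonNegInQ³ (λ n → sym (q-^ 3 n)) (nonNeg , inQ³)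
  where
  nonNeg : NonNegative (q^ 3)
  nonNeg (suc (suc (suc n))) = q^0-nonNegative n
  nonNeg 0 = +≤+ z≤n
  nonNeg 1 = +≤+ z≤n
  nonNeg 2 = +≤+ z≤n
  inQ³ : InQ³ (q^ 3)
  inQ³ zero    = refl , refl
  inQ³ (suc n) = refl , refl

open Products order-complete q Vq using (poch; poch-product; power)
open ThetaQuotients order-complete q Vq nonNegInQ³ Kq³
open import Algebra.Properties.Semiring.Exp (CommutativeRing.semiring powerSeriesRing) using (^-assocʳ)

-- In g = (1 - q^3) g + q^3 g the first summand is nonnegative with constant term 1, so positivity
-- starts at index 0 and is carried on in steps of three.
strict-positive : ∀ {g} → Strict g → ∀ n → 0ℤ ℤ.< g (triple n)
strict-positive {g} ((ng , _) , (nh , _) , h≈1) = go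
  where
  h : PowerSeries
  h = (q^ 0 ⊕ (λ n → ℤ.- (q ^ 3) n)) ⊛ g
  go : ∀ n → 0ℤ ℤ.< g (triple n)
  go zero = subst (0ℤ ℤ.<_) (sym (trans (unroll g 0)
      (cong₂ ℤ._+_ (≈[]⇒≡ {h} {q^ 0} {1} 0 (s≤s z≤n) h≈1) refl)))
    (+<+ (s≤s z≤n))
  go (suc n) = subst (0ℤ ℤ.<_) (sym
      (trans (unroll g (triple (suc n)))
      (cong (λ y → h (triple (suc n)) ℤ.+ y) (q^3-shift g (triple n)))))
    (ℤ.+-mono-≤-< (nh (triple (suc n))) (go n))

positive-coefficients : ∀ {g} → Positive g → (∀ n → 0ℤ ℤ.< g (triple n)) × InQ³ g
positive-coefficients (g , h , s@((_ , ig) , _) , (nh , ih) , e) =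
  (λ n → subst (0ℤ ℤ.<_) (sym (e _)) (ℤ.+-mono-<-≤ (strict-positive s n) (nh (triple n)))) ,
  (λ n → trans (e _) (cong₂ ℤ._+_ (proj₁ (ig n)) (proj₁ (ih n))) , trans (e _)
      (cong₂ ℤ._+_ (proj₂ (ig n)) (proj₂ (ih n))))

triple≡3* : ∀ n → triple n ≡ 3 * n
triple≡3* zero    = refl
triple≡3* (suc n) = trans (cong (λ m → 3 + m) (triple≡3* n)) (sym (ℕ.*-suc 3 n))

SignPattern : PowerSeries → Set
SignPattern x = ∀ n → (x (3 * n) > 0ℤ) × (x (3 * n + 1) < 0ℤ) × (x (3 * n + 2) ≡ 0ℤ)

split-signs : ∀ {x} → Split x → SignPattern x
split-signs {x} (g , h , pg , ph , e) n with positive-coefficients pg | positive-coefficients ph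
... | g₊ , ig | h₊ , ih =
  subst (λ m → x m > 0ℤ) (triple≡3* n) (subst (ℤ._> 0ℤ) (sym (residue₀ n)) (g₊ n)) ,
  subst (λ m → x m < 0ℤ) (index 1) (subst (ℤ._< 0ℤ) (sym residue₁) (ℤ.neg-mono-< (h₊ n))) ,
  subst (λ m → x m ≡ 0ℤ) (index 2) residue₂
  where
  index : ∀ r → r + triple n ≡ 3 * n + r
  index r = trans (ℕ.+-comm r (triple n)) (cong (λ m → m + r) (triple≡3* n))
  residue₀ : ∀ n → x (triple n) ≡ g (triple n)
  -- The constant term of q h is zero; at later multiples of 3 its coefficient is one of h at an
  -- index congruent to 2.
  residue₀ zero    = trans (e 0) (ℤ.+-identityʳ (g 0))
  residue₀ (suc n) = trans (e _) (trans
      (cong (λ y → g _ ℤ.+ ℤ.- y) (trans (q^-shift h _) (proj₂ (ih n)))) (ℤ.+-identityʳ (g _)))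
  residue₁ : x (suc (triple n)) ≡ ℤ.- h (triple n)
  residue₁ = trans (e _) (trans (cong₂ (λ y z → y ℤ.+ ℤ.- z) (proj₁ (ig n)) (q^-shift h _))
      (ℤ.+-identityˡ _))
  residue₂ : x (suc (suc (triple n))) ≡ 0ℤ
  residue₂ = trans (e _) (cong₂ (λ y z → y ℤ.+ ℤ.- z) (proj₂ (ig n))
      (trans (q^-shift h _) (proj₁ (ih n))))

-- Identification of the Euler products, and the conclusion

f≗poch : ∀ j .{{_ : NonZero j}} → f j ≗ poch j j
f≗poch j = limit-unique {partialProduct j} {f j} {poch j j}
  (λ L → L , λ K L≤K → ≡⇒≈[] {partialProduct j K} {f j} λ i i<L → proj₂ (f-isLimit j i) K
      (ℕ.≤-trans (ℕ.<⇒≤ i<L) L≤K))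
  (⟶-resp {Π< (λ i → q^ 0 ⊕ (λ n → ℤ.- power j j i n))} {partialProduct j} {poch j j} partial
      (poch-product j j))
  where
  power≗ : ∀ i → power j j i ≗ q^ (j * suc i)
  power≗ i n = trans (^-assocʳ q j (suc i) n) (q-^ (j * suc i) n)
  partial : ∀ K → Π< (λ i → q^ 0 ⊕ (λ n → ℤ.- power j j i n)) K ≗ partialProduct j K
  partial zero    n = refl
  partial (suc K) n = ⊛-cong {Π< (λ i → q^ 0 ⊕ (λ n → ℤ.- power j j i n)) K} {partialProduct j K}
      {q^ 0 ⊕ (λ n → ℤ.- power j j K n)} {q^ 0 ⊖ q^ (j * suc K)} (partial K)
      (λ m → cong (λ x → (q^ 0) m ℤ.+ ℤ.- x) (power≗ K m)) n

f-inverse : ∀ j .{{_ : NonZero j}} → f j ⊛ f j ⁻¹ ≗ q^ 0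
f-inverse j = ⁻¹-inverseʳ (f j) (f-constantTerm j)

theorem3p2 : ∀ (t : Vec ℤ 4) → t ∈ S₃ →
    ∀ (n : ℕ) →
    (a t (3 * n) > 0ℤ) × (a t (3 * n + 1) < 0ℤ) × (a t (3 * n + 2) ≡ 0ℤ)
theorem3p2 t (here refl) = split-signs {a t}
    (split-f₁³/f₃² {f 1} {f 2} {f 3} {f 4} {f 3 ⁻¹} (f≗poch 1) (f≗poch 3) (f-inverse 3))
theorem3p2 t (there (here refl)) = split-signs {a t}
  (split-f₁f₄/f₂f₃² {f 1} {f 2} {f 3} {f 4} {f 2 ⁻¹} {f 3 ⁻¹} (f≗poch 1) (f≗poch 2) (f≗poch 3)
      (f≗poch 4) (f-inverse 2) (f-inverse 3))
theorem3p2 t (there (there (here refl))) = split-signs {a t}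
  (split-f₁²/f₂f₃² {f 1} {f 2} {f 3} {f 4} {f 2 ⁻¹} {f 3 ⁻¹} (f≗poch 1) (f≗poch 2) (f≗poch 3)
      (f≗poch 4) (f-inverse 2) (f-inverse 3))
theorem3p2 t (there (there (there ())))
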